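{- Let $n\ge 4$ and $0\le k\le n-2$ be integers, and let $G$ be a connected $k$-cyclic graph with $n$ vertices. Then $$\sigma(G)\le (n-1)(n-2)^2-2k(2n-5)+k^2(k-1),$$ with equality if and only if $G=H_{n,k}$.
   Context: All graphs are finite and simple. For a graph $G$ with edge set $E(G)$ and $d_w$ denoting the degree of a vertex $w$, the sigma index is $\sigma(G)=\sum_{uv\in E(G)}(d_u-d_v)^2$. A connected $k$-cyclic graph is a connected graph of order $n$ and size $n+k-1$. The star $S_n$ is the graph on $n$ vertices with one vertex (the center) adjacent to all other $n-1$ vertices (the pendent vertices) and no other edges. For $n\ge 4$ and $1\le k\le n-2$, $H_{n,k}$ is the graph obtained from $S_n$ by fixing one pendent vertex $u$ and adding $k$ edges joining $u$ to $k$ other pendent vertices of $S_n$; also $H_{n,0}=S_n$. -}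

module Defs where

open import Data.Bool using (Bool; true; false; _∧_; _∨_; not; T)
open import Data.Nat using (ℕ; zero; suc; _+_; _*_; _∸_; _^_; _≤ᵇ_; _<ᵇ_; _≡ᵇ_; ∣_-_∣)
open import Data.Fin using (Fin; toℕ)
open import Data.List using (List; map)
open import Data.Nat.ListAction using (sum)
open import Data.List using () renaming (allFin to allFinL)
open import Data.Product using (Σ; _×_)
open import Relation.Binary.PropositionalEquality using (_≡_; refl; cong; cong₂)
open import Relation.Binary.Construct.Closure.ReflexiveTransitive using (Star)
open import Function.Bundles using (_↔_; Inverse)

record Graph (n : ℕ) : Set where
  field
    adj     : Fin n → Fin n → Bool
    adj-sym : ∀ i j → adj i j ≡ adj j i
    irrefl  : ∀ i → adj i i ≡ false
open Graph public

ΣV : ∀ {n} → (Fin n → ℕ) → ℕ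
ΣV {n} f = sum (map f (allFinL n))

ΣE : ∀ {n} → Graph n → (Fin n → Fin n → ℕ) → ℕ
ΣE G f = ΣV λ i → ΣV λ j → if′ ((toℕ i <ᵇ toℕ j) ∧ adj G i j) (f i j)
  where
  if′ : Bool → ℕ → ℕ
  if′ true  x = x
  if′ false _ = 0

deg : ∀ {n} → Graph n → Fin n → ℕ
deg G i = ΣV λ j → if adj G i j then 1 else 0
  where
  open import Data.Bool using (if_then_else_)

size : ∀ {n} → Graph n → ℕ
size G = ΣE G (λ _ _ → 1)

Connected : ∀ {n} → Graph n → Set
Connected {n} G = ∀ (i j : Fin n) → Star (λ a b → T (adj G a b)) i j

KCyclic : ∀ {n} → ℕ → Graph n → Set
KCyclic {n} k G = Connected G × (size G + 1 ≡ n + k)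

sigma : ∀ {n} → Graph n → ℕ
sigma G = ΣE G (λ i j → ∣ deg G i - deg G j ∣ ^ 2)

_≅_ : ∀ {n} → Graph n → Graph n → Set
_≅_ {n} G H = Σ (Fin n ↔ Fin n) λ f →
  ∀ i j → adj G i j ≡ adj H (Inverse.to f i) (Inverse.to f j)

-- H_{n,k}: vertex 0 is the centre of the star S_n, vertex 1 is the fixed
-- pendent vertex u, and u is joined to the k pendent vertices 2, …, k+1.
-- (H_{n,0} = S_n.)
Hadj : (n k : ℕ) → Fin n → Fin n → Bool
Hadj n k i j =
  not (toℕ i ≡ᵇ toℕ j) ∧
  ( (toℕ i ≡ᵇ 0) ∨ (toℕ j ≡ᵇ 0)
  ∨ ((toℕ i ≡ᵇ 1) ∧ (2 ≤ᵇ toℕ j) ∧ (toℕ j ≤ᵇ suc k))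
  ∨ ((toℕ j ≡ᵇ 1) ∧ (2 ≤ᵇ toℕ i) ∧ (toℕ i ≤ᵇ suc k)) )

private
  ≡ᵇ-comm : ∀ m n → (m ≡ᵇ n) ≡ (n ≡ᵇ m)
  ≡ᵇ-comm zero zero = refl
  ≡ᵇ-comm zero (suc n) = refl
  ≡ᵇ-comm (suc m) zero = refl
  ≡ᵇ-comm (suc m) (suc n) = ≡ᵇ-comm m n

  ≡ᵇ-refl : ∀ m → (m ≡ᵇ m) ≡ true
  ≡ᵇ-refl zero = refl
  ≡ᵇ-refl (suc m) = ≡ᵇ-refl m

  swap4 : ∀ a b c d → (a ∨ b ∨ c ∨ d) ≡ (b ∨ a ∨ d ∨ c)
  swap4 true  true  c d = refl
  swap4 true  false c d = refl
  swap4 false true  c d = refl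
  swap4 false false true  true  = refl
  swap4 false false true  false = refl
  swap4 false false false true  = refl
  swap4 false false false false = refl

H : (n k : ℕ) → Graph n
H n k = record { adj = Hadj n k ; adj-sym = s ; irrefl = r }
  where
  s : ∀ i j → Hadj n k i j ≡ Hadj n k j i
  s i j = cong₂ _∧_ (cong not (≡ᵇ-comm (toℕ i) (toℕ j)))
                    (swap4 (toℕ i ≡ᵇ 0) (toℕ j ≡ᵇ 0)
                       ((toℕ i ≡ᵇ 1) ∧ (2 ≤ᵇ toℕ j) ∧ (toℕ j ≤ᵇ suc k))
                       ((toℕ j ≡ᵇ 1) ∧ (2 ≤ᵇ toℕ i) ∧ (toℕ i ≤ᵇ suc k)))
  r : ∀ i → Hadj n k i i ≡ false
  r i rewrite ≡ᵇ-refl (toℕ i) = refl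

{-# OPTIONS --safe #-}
module Submission where

open import Defs
open import Algebra.Bundles using (CommutativeSemiring)
open import Data.Bool using (Bool; true; false; not; _∧_; if_then_else_)
open import Data.Bool.Properties using (∧-zeroʳ; ∨-identityʳ)
open import Data.Fin using (Fin; zero; suc; toℕ; punchIn)
open import Data.Fin.Patterns using (0F; 1F; 2F; 3F)
open import Data.Fin.Permutation as Perm using (Permutation; _⟨$⟩ʳ_)
open import Data.Fin.Properties using (_≟_; <-cmp; any?; punchInᵢ≢i)
open import Data.Integer using (ℤ; +_; _+_; _-_; _*_; 0ℤ; 1ℤ; -[1+_]; ∣_∣; +≤+; _⊖_) renaming (_≤_ to _≤ℤ_)
open import Data.Integer.Properties as ℤ hiding (_≟_; <-cmp)
open import Algebra.Properties.Semiring.Sum (CommutativeSemiring.semiring +-*-commutativeSemiring) as Sum using (sum)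
open import Data.Integer.Tactic.RingSolver using (solve; solve-∀)
open import Data.List using (_∷_; []; tabulate; allFin)
open import Data.List.Properties using (map-cong; map-tabulate)
open import Data.Nat using (ℕ; _≤_; _∸_; _<ᵇ_; z≤n)
import Data.Nat as ℕ
import Data.Nat.ListAction as ListAction
import Data.Nat.Properties as ℕ
open import Data.Product using (∃; _×_; _,_; proj₁; proj₂)
open import Data.Sum using (_⊎_; inj₁; inj₂) renaming (map to ⊎-map)
open import Function using (id; _∘_)
open import Function.Bundles using (_⇔_; mk⇔; Inverse)
open import Relation.Binary using (tri<; tri≈; tri>)
open import Relation.Binary.PropositionalEquality
open import Relation.Nullary using (¬_; Dec; does; yes; no; contradiction; ¬?; _×-dec_)
import Relation.Nullary.Decidable as Dec

-- Let w be a vertex of maximum degree D + 1, let t be the number of vertices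
-- other than w not adjacent to w, and let x(v) be the degree of v in G - w.
-- Expanding the terms (D - x(v))² of the edges at w and distributing the result
-- over the edges of G - w, σ(G) equals (D + 1) D² plus a sum of weights over the
-- k + t edges ij of G - w.  These satisfy x(i) + x(j) ≤ k + t + 1, and at most t
-- of them have an end of degree one in G.
--
-- If t = 0, every weight is largest when {x(i), x(j)} = {k, 1}; this gives the
-- bound, with equality only if some vertex u has x(u) = k, that is, if all edges
-- of G - w meet u.  If t ≥ 1, bounding the weights separately for edges with and
-- without an end of degree one gives a strict inequality, for which the cases
-- k + t ≤ D, k + t = D + 1 and k + t ≥ D + 2 are treated apart.

-- An edge wv contributes (D - x(v))² = D² + x(v)(x(v) - 2D). The correction is a multiple of x(v),
-- so each of the x(v) edges of G - w at v can take over x(v) - 2D. A single bound for all weights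
-- is too weak when t ≥ 1: for t = 1 and D = q = k + 1, charging `q * q - q + + 3` to each of the k
-- + t edges overshoots the claimed bound by 4k² - k - 7. Weights that large need an end of degree
-- one, and such an end spends its only edge in G - w, so it is one of the t vertices not adjacent
-- to w. Hence at most t edges are charged a large constant `P`, and the others a smaller `M`. The
-- polynomial inequalities are proved by certificates: a difference is written as a sum of products
-- of quantities known to be nonnegative, and the ring solver checks the identity.

infixr 6 _⊕_
infixr 7 _⊗_

_⊕_ : ∀ {i j} → 0ℤ ≤ℤ i → 0ℤ ≤ℤ j → 0ℤ ≤ℤ i + j
_⊕_ = +-mono-≤

_⊗_ : ∀ {i j} → 0ℤ ≤ℤ i → 0ℤ ≤ℤ j → 0ℤ ≤ℤ i * j
_⊗_ {+ m} {+ n} _ _ = subst (0ℤ ≤ℤ_) (pos-* m n) (+≤+ z≤n)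

lit : ∀ n → 0ℤ ≤ℤ + n
lit _ = +≤+ z≤n

slack : ∀ {i j} → i ≤ℤ j → 0ℤ ≤ℤ j - i
slack = i≤j⇒0≤j-i

-- Here `s` is the certificate, and `i′` is the unfolded form of an `i` that may be opaque, such as
-- a `weight`.
≤-via : ∀ {i i′ j s} → i ≡ i′ → 0ℤ ≤ℤ s → j - i′ ≡ s → i ≤ℤ j
≤-via refl 0≤s eq = 0≤i-j⇒j≤i (subst (0ℤ ≤ℤ_) (sym eq) 0≤s)

1+i≰i : ∀ i → ¬ 1ℤ + i ≤ℤ i
1+i≰i i 1+i≤i = <-irrefl refl (suc[i]≤j⇒i<j 1+i≤i)

-- Edge weights and their upper bounds

⟦_⟧ : Bool → ℤ
⟦ true ⟧ = 1ℤ
⟦ false ⟧ = 0ℤ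

abstract
  -- The contribution of an edge avoiding the vertex w of degree D + 1, once the
  -- edges at w have been expanded around D²: x and y are the degrees of its ends
  -- in the graph without w, and α, β tell whether these ends are adjacent to w.
  weight : (D α β x y : ℤ) → ℤ
  weight D α β x y =
    α * (x - + 2 * D) + β * (y - + 2 * D) + (x + α - (y + β)) * (x + α - (y + β))

  weight-sym : ∀ D α β x y → weight D α β x y ≡ weight D β α y x
  weight-sym = expand
    where
    expand : ∀ D α β x y →
      α * (x - + 2 * D) + β * (y - + 2 * D) + (x + α - (y + β)) * (x + α - (y + β)) ≡
      β * (y - + 2 * D) + α * (x - + 2 * D) + (y + β - (x + α)) * (y + β - (x + α))
    expand = solve-∀

  weight₁₁ : ∀ D x y → weight D 1ℤ 1ℤ x y ≡ x + y - + 4 * D + (x - y) * (x - y)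
  weight₁₁ = expand
    where
    expand : ∀ D x y →
      1ℤ * (x - + 2 * D) + 1ℤ * (y - + 2 * D) + (x + 1ℤ - (y + 1ℤ)) * (x + 1ℤ - (y + 1ℤ)) ≡
      x + y - + 4 * D + (x - y) * (x - y)
    expand = solve-∀

  weight₁₀ : ∀ D x y → weight D 1ℤ 0ℤ x y ≡ x - + 2 * D + (x + 1ℤ - y) * (x + 1ℤ - y)
  weight₁₀ = expand
    where
    expand : ∀ D x y →
      1ℤ * (x - + 2 * D) + 0ℤ * (y - + 2 * D) + (x + 1ℤ - (y + 0ℤ)) * (x + 1ℤ - (y + 0ℤ)) ≡
      x - + 2 * D + (x + 1ℤ - y) * (x + 1ℤ - y)
    expand = solve-∀

  weight₀₀ : ∀ D x y → weight D 0ℤ 0ℤ x y ≡ (x - y) * (x - y)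
  weight₀₀ = expand
    where
    expand : ∀ D x y →
      0ℤ * (x - + 2 * D) + 0ℤ * (y - + 2 * D) + (x + 0ℤ - (y + 0ℤ)) * (x + 0ℤ - (y + 0ℤ)) ≡
      (x - y) * (x - y)
    expand = solve-∀

  weight-def : ∀ D α β x y → weight D α β x y ≡
    α * (x - + 2 * D) + β * (y - + 2 * D) + (x + α - (y + β)) * (x + α - (y + β))
  weight-def D α β x y = refl

private
  -- The constant comes from this case: for {x, y} = {q, 1} and D = q - 1 the weight is q² - 5q + 6.
  -- One more is allowed, and the same value then serves the two other adjacency types, where an end
  -- not adjacent to w has `x` or `y` at least 2.
  weight₁₁≤-nonpendant : ∀ D q x y → 1ℤ ≤ℤ x → 1ℤ ≤ℤ y → x + y ≤ℤ q + 1ℤ → q ≤ℤ D + 1ℤ →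
    weight D 1ℤ 1ℤ x y ≤ℤ q * q - + 5 * q + + 7
  weight₁₁≤-nonpendant D q x y 1≤x 1≤y x+y≤q+1 q≤D+1 = ≤-via (weight₁₁ D x y)
    -- The product is the difference of squares (q - 1)² - (x - y)². The neighbouring certificates
    -- have the same shape, with q - 2 against x + 1 - y or q - 3 against x - y where larger lower
    -- bounds are available.
    ((slack x+y≤q+1 ⊕ lit 2 ⊗ slack 1≤y) ⊗ (slack x+y≤q+1 ⊕ lit 2 ⊗ slack 1≤x)
      ⊕ slack x+y≤q+1 ⊕ lit 4 ⊗ slack q≤D+1 ⊕ lit 1)
    (solve (D ∷ q ∷ x ∷ y ∷ []))

  weight₁₀≤-nonpendant : ∀ D q x y → 1ℤ ≤ℤ x → + 2 ≤ℤ y + 0ℤ → x + y ≤ℤ q + 1ℤ → q ≤ℤ D + 1ℤ →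
    weight D 1ℤ 0ℤ x y ≤ℤ q * q - + 5 * q + + 7
  weight₁₀≤-nonpendant D q x y 1≤x 2≤y x+y≤q+1 q≤D+1 = ≤-via (weight₁₀ D x y)
    ((slack x+y≤q+1 ⊕ lit 2 ⊗ slack 2≤y) ⊗ (slack x+y≤q+1 ⊕ lit 2 ⊗ slack 1≤x)
      ⊕ (slack x+y≤q+1 ⊕ slack 2≤y) ⊕ lit 2 ⊗ slack q≤D+1 ⊕ lit 2)
    (solve (D ∷ q ∷ x ∷ y ∷ []))

  weight₀₀≤-nonpendant : ∀ D q x y → + 2 ≤ℤ x + 0ℤ → + 2 ≤ℤ y + 0ℤ → x + y ≤ℤ q + 1ℤ →
    weight D 0ℤ 0ℤ x y ≤ℤ q * q - + 5 * q + + 7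
  weight₀₀≤-nonpendant D q x y 2≤x 2≤y x+y≤q+1 = ≤-via (weight₀₀ D x y)
    ((slack x+y≤q+1 ⊕ lit 2 ⊗ slack 2≤y) ⊗ (slack x+y≤q+1 ⊕ lit 2 ⊗ slack 2≤x)
      ⊕ slack x+y≤q+1 ⊕ slack 2≤x ⊕ slack 2≤y ⊕ lit 1)
    (solve (D ∷ q ∷ x ∷ y ∷ []))

  -- The size of the constant is set by an edge with x = q, y = 1 whose first end alone is adjacent
  -- to w, which has weight q² - q when D = q. The `+ 3` leaves room for all types; in the present
  -- one the term -4D is estimated merely by 0, which costs 2.
  weight₁₁≤-low : ∀ D q x y → 0ℤ ≤ℤ D → 1ℤ ≤ℤ x → 1ℤ ≤ℤ y → x + y ≤ℤ q + 1ℤ →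
    weight D 1ℤ 1ℤ x y ≤ℤ q * q - q + + 3
  weight₁₁≤-low D q x y 0≤D 1≤x 1≤y x+y≤q+1 = ≤-via (weight₁₁ D x y)
    ((slack x+y≤q+1 ⊕ lit 2 ⊗ slack 1≤y) ⊗ (slack x+y≤q+1 ⊕ lit 2 ⊗ slack 1≤x)
      ⊕ slack x+y≤q+1 ⊕ lit 4 ⊗ 0≤D ⊕ lit 1)
    (solve (D ∷ q ∷ x ∷ y ∷ []))

  weight₁₀≤-low : ∀ D q x y → 1ℤ ≤ℤ x → 1ℤ ≤ℤ y → x + y ≤ℤ q + 1ℤ → q ≤ℤ D →
    weight D 1ℤ 0ℤ x y ≤ℤ q * q - q + + 3
  weight₁₀≤-low D q x y 1≤x 1≤y x+y≤q+1 q≤D = ≤-via (weight₁₀ D x y)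
    ((slack x+y≤q+1 ⊕ lit 2 ⊗ slack 1≤y) ⊗ (slack x+y≤q+1 ⊕ lit 2 ⊗ slack 1≤x ⊕ lit 2)
      ⊕ (slack x+y≤q+1 ⊕ slack 1≤y) ⊕ lit 2 ⊗ slack q≤D ⊕ lit 3)
    (solve (D ∷ q ∷ x ∷ y ∷ []))

  weight₀₀≤-low : ∀ D q x y → 1ℤ ≤ℤ x → 1ℤ ≤ℤ y → x + y ≤ℤ q + 1ℤ →
    weight D 0ℤ 0ℤ x y ≤ℤ q * q - q + + 3
  weight₀₀≤-low D q x y 1≤x 1≤y x+y≤q+1 = ≤-via (weight₀₀ D x y)
    ((slack x+y≤q+1 ⊕ lit 2 ⊗ slack 1≤y) ⊗ (slack x+y≤q+1 ⊕ lit 2 ⊗ slack 1≤x)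
      ⊕ slack x+y≤q+1 ⊕ slack 1≤x ⊕ slack 1≤y ⊕ lit 3)
    (solve (D ∷ q ∷ x ∷ y ∷ []))

  -- Both degrees lie between L and D + 1, which bounds the square of their difference. The linear
  -- corrections only help: an end adjacent to w has x ≤ D, so x - 2D ≤ 0.
  weight₁₁≤-spread : ∀ D L x y → 0ℤ ≤ℤ D → L ≤ℤ x + 1ℤ → L ≤ℤ y + 1ℤ →
    x + 1ℤ ≤ℤ D + 1ℤ → y + 1ℤ ≤ℤ D + 1ℤ → weight D 1ℤ 1ℤ x y ≤ℤ (D + 1ℤ - L) * (D + 1ℤ - L)
  weight₁₁≤-spread D L x y 0≤D L≤x L≤y x≤ y≤ = ≤-via (weight₁₁ D x y)
    ((slack x≤ ⊕ slack L≤y) ⊗ (slack y≤ ⊕ slack L≤x) ⊕ (slack x≤ ⊕ 0≤D) ⊕ (slack y≤ ⊕ 0≤D))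
    (solve (D ∷ L ∷ x ∷ y ∷ []))

  weight₁₀≤-spread : ∀ D L x y → 0ℤ ≤ℤ D → L ≤ℤ x + 1ℤ → L ≤ℤ y + 0ℤ →
    x + 1ℤ ≤ℤ D + 1ℤ → y + 0ℤ ≤ℤ D + 1ℤ → weight D 1ℤ 0ℤ x y ≤ℤ (D + 1ℤ - L) * (D + 1ℤ - L)
  weight₁₀≤-spread D L x y 0≤D L≤x L≤y x≤ y≤ = ≤-via (weight₁₀ D x y)
    ((slack x≤ ⊕ slack L≤y) ⊗ (slack y≤ ⊕ slack L≤x) ⊕ (slack x≤ ⊕ 0≤D))
    (solve (D ∷ L ∷ x ∷ y ∷ []))

  weight₀₀≤-spread : ∀ D L x y → L ≤ℤ x + 0ℤ → L ≤ℤ y + 0ℤ →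
    x + 0ℤ ≤ℤ D + 1ℤ → y + 0ℤ ≤ℤ D + 1ℤ → weight D 0ℤ 0ℤ x y ≤ℤ (D + 1ℤ - L) * (D + 1ℤ - L)
  weight₀₀≤-spread D L x y L≤x L≤y x≤ y≤ = ≤-via (weight₀₀ D x y)
    ((slack x≤ ⊕ slack L≤y) ⊗ (slack y≤ ⊕ slack L≤x))
    (solve (D ∷ L ∷ x ∷ y ∷ []))

weight≤-nonpendant : ∀ {D q} a b {x y} → 1ℤ ≤ℤ x → 1ℤ ≤ℤ y → x + y ≤ℤ q + 1ℤ →
  + 2 ≤ℤ x + ⟦ a ⟧ → + 2 ≤ℤ y + ⟦ b ⟧ → q ≤ℤ D + 1ℤ →
  weight D ⟦ a ⟧ ⟦ b ⟧ x y ≤ℤ q * q - + 5 * q + + 7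
weight≤-nonpendant true true 1≤x 1≤y x+y≤q+1 _ _ q≤D+1 =
  weight₁₁≤-nonpendant _ _ _ _ 1≤x 1≤y x+y≤q+1 q≤D+1
weight≤-nonpendant true false 1≤x _ x+y≤q+1 _ 2≤y q≤D+1 =
  weight₁₀≤-nonpendant _ _ _ _ 1≤x 2≤y x+y≤q+1 q≤D+1
weight≤-nonpendant {D} {q} false true {x} {y} _ 1≤y x+y≤q+1 2≤x _ q≤D+1 =
  subst (_≤ℤ q * q - + 5 * q + + 7) (weight-sym D 1ℤ 0ℤ y x)
    (weight₁₀≤-nonpendant D q y x 1≤y 2≤x (subst (_≤ℤ q + 1ℤ) (+-comm x y) x+y≤q+1) q≤D+1)
weight≤-nonpendant {q = q} false false _ _ x+y≤q+1 2≤x 2≤y _ =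
  weight₀₀≤-nonpendant _ q _ _ 2≤x 2≤y x+y≤q+1

weight≤-low : ∀ {D q} a b {x y} → 0ℤ ≤ℤ D → 1ℤ ≤ℤ x → 1ℤ ≤ℤ y → x + y ≤ℤ q + 1ℤ → q ≤ℤ D →
  weight D ⟦ a ⟧ ⟦ b ⟧ x y ≤ℤ q * q - q + + 3
weight≤-low {q = q} true true 0≤D 1≤x 1≤y x+y≤q+1 _ = weight₁₁≤-low _ q _ _ 0≤D 1≤x 1≤y x+y≤q+1
weight≤-low true false _ 1≤x 1≤y x+y≤q+1 q≤D = weight₁₀≤-low _ _ _ _ 1≤x 1≤y x+y≤q+1 q≤D
weight≤-low {D} {q} false true {x} {y} _ 1≤x 1≤y x+y≤q+1 q≤D =
  subst (_≤ℤ q * q - q + + 3) (weight-sym D 1ℤ 0ℤ y x)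
    (weight₁₀≤-low D q y x 1≤y 1≤x (subst (_≤ℤ q + 1ℤ) (+-comm x y) x+y≤q+1) q≤D)
weight≤-low {q = q} false false _ 1≤x 1≤y x+y≤q+1 _ = weight₀₀≤-low _ q _ _ 1≤x 1≤y x+y≤q+1

weight≤-spread : ∀ {D} L a b {x y} → 0ℤ ≤ℤ D → L ≤ℤ x + ⟦ a ⟧ → L ≤ℤ y + ⟦ b ⟧ →
  x + ⟦ a ⟧ ≤ℤ D + 1ℤ → y + ⟦ b ⟧ ≤ℤ D + 1ℤ →
  weight D ⟦ a ⟧ ⟦ b ⟧ x y ≤ℤ (D + 1ℤ - L) * (D + 1ℤ - L)
weight≤-spread L true true = weight₁₁≤-spread _ L _ _
weight≤-spread L true false = weight₁₀≤-spread _ L _ _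
weight≤-spread {D} L false true {x} {y} 0≤D L≤x L≤y x≤ y≤ =
  subst (_≤ℤ (D + 1ℤ - L) * (D + 1ℤ - L)) (weight-sym D 1ℤ 0ℤ y x)
    (weight₁₀≤-spread D L y x 0≤D L≤y L≤x y≤ x≤)
weight≤-spread L false false _ = weight₀₀≤-spread _ L _ _

-- The sum x + y and the spread of x and y reach their largest values k + 1 and k - 1 together, at
-- {k, 1}.
weight₁₁≤ : ∀ D k x y → 1ℤ ≤ℤ x → 1ℤ ≤ℤ y → x + y ≤ℤ k + 1ℤ →
  weight D 1ℤ 1ℤ x y ≤ℤ k * k - k + + 2 - + 4 * D
weight₁₁≤ D k x y 1≤x 1≤y x+y≤k+1 = ≤-via (weight₁₁ D x y)
  ((slack x+y≤k+1 ⊕ lit 2 ⊗ slack 1≤y) ⊗ (slack x+y≤k+1 ⊕ lit 2 ⊗ slack 1≤x)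
    ⊕ slack x+y≤k+1)
  (solve (D ∷ k ∷ x ∷ y ∷ []))

-- With k excluded as a value, the spread is at most k - 2. This lowers the weight by 2k - 3 at
-- least, and k ≥ 2 follows from 1 ≤ x < k.
weight₁₁< : ∀ D k x y → 1ℤ ≤ℤ x → 1ℤ ≤ℤ y → x + y ≤ℤ k + 1ℤ → x + 1ℤ ≤ℤ k → y + 1ℤ ≤ℤ k →
  weight D 1ℤ 1ℤ x y ≤ℤ k * k - k + + 2 - + 4 * D - 1ℤ
weight₁₁< D k x y 1≤x 1≤y x+y≤k+1 x<k y<k = ≤-via (weight₁₁ D x y)
  ((slack x<k ⊕ slack 1≤y) ⊗ (slack y<k ⊕ slack 1≤x)
    ⊕ slack x+y≤k+1 ⊕ lit 2 ⊗ slack x<k ⊕ lit 2 ⊗ slack 1≤x)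
  (solve (D ∷ k ∷ x ∷ y ∷ []))

weight₁₁-extremal : ∀ D k → weight D 1ℤ 1ℤ k 1ℤ ≡ k * k - k + + 2 - + 4 * D
weight₁₁-extremal D k = trans (weight₁₁ D k 1ℤ) (expand D k)
  where
  expand : ∀ D k → k + 1ℤ - + 4 * D + (k - 1ℤ) * (k - 1ℤ) ≡ k * k - k + + 2 - + 4 * D
  expand = solve-∀

-- Polynomial comparison of the estimates with the bound

abstract
  sigmaBound : ℤ → ℤ → ℤ
  sigmaBound N K = (N - + 1) * (N - + 2) * (N - + 2) - + 2 * K * (+ 2 * N - + 5) + K * K * (K - + 1)

  sigmaBound-def : ∀ N K → sigmaBound N K ≡
    (N - + 1) * (N - + 2) * (N - + 2) - + 2 * K * (+ 2 * N - + 5) + K * K * (K - + 1)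
  sigmaBound-def N K = refl

  -- The edges at w contribute D² each in the first place; of the k + t others,
  -- at most t have a pendent end, and P bounds these, M the remaining ones.
  estimate : (D t k P M : ℤ) → ℤ
  estimate D t k P M = (D + 1ℤ) * (D * D) + t * P + k * M

  estimate-def : ∀ D t k P M → estimate D t k P M ≡ (D + 1ℤ) * (D * D) + t * P + k * M
  estimate-def D t k P M = refl

  bound-dominating : ∀ D k P →
    sigmaBound (D + + 2) k ≡ estimate D 0ℤ k P (k * k - k + + 2 - + 4 * D)
  bound-dominating = expand
    where
    expand : ∀ D k P → let N = D + + 2 in
      (N - + 1) * (N - + 2) * (N - + 2) - + 2 * k * (+ 2 * N - + 5) + k * k * (k - + 1) ≡
      (D + 1ℤ) * (D * D) + 0ℤ * P + k * (k * k - k + + 2 - + 4 * D)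
    expand = solve-∀

  -- In the variables k, s = t - 1 and e = D - (k + t) the difference expands with nonnegative
  -- coefficients only.
  bound-gap-low : ∀ D t k → 0ℤ ≤ℤ k → 0ℤ ≤ℤ t - 1ℤ → 0ℤ ≤ℤ D - (k + t) → let q = k + t in
    1ℤ + estimate D t k (q * q - q + + 3) (q * q - + 5 * q + + 7) ≤ℤ sigmaBound (D + + 2 + t) k
  bound-gap-low D t k 0≤k 0≤s 0≤e = ≤-via refl
    (0≤s ⊗ (lit 3 ⊗ 0≤e ⊗ 0≤e ⊕ lit 6 ⊗ 0≤e ⊗ 0≤k ⊕ lit 9 ⊗ 0≤e ⊗ 0≤s ⊕ lit 6 ⊗ 0≤k ⊗ 0≤s
             ⊕ lit 6 ⊗ 0≤s ⊗ 0≤s ⊕ lit 20 ⊗ 0≤e ⊕ lit 12 ⊗ 0≤k ⊕ lit 22 ⊗ 0≤s ⊕ lit 23)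
      ⊕ lit 3 ⊗ 0≤e ⊗ 0≤e ⊕ lit 2 ⊗ 0≤e ⊗ 0≤k ⊕ lit 11 ⊗ 0≤e ⊕ 0≤k ⊕ lit 6)
    (expand D t k)
    where
    expand : ∀ D t k → let q = k + t ; N = D + + 2 + t ; s = t - 1ℤ ; e = D - (k + t) in
      (N - + 1) * (N - + 2) * (N - + 2) - + 2 * k * (+ 2 * N - + 5) + k * k * (k - + 1)
        - (1ℤ + ((D + 1ℤ) * (D * D) + t * (q * q - q + + 3) + k * (q * q - + 5 * q + + 7))) ≡
      s * (+ 3 * (e * e) + (+ 6 * (e * k) + (+ 9 * (e * s) + (+ 6 * (k * s)
        + (+ 6 * (s * s) + (+ 20 * e + (+ 12 * k + (+ 22 * s + + 23))))))))
      + (+ 3 * (e * e) + (+ 2 * (e * k) + (+ 11 * e + (k + + 6))))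
    expand = solve-∀

  -- This case is nearly tight: at t = 1 the bound exceeds the estimate by exactly 2, whatever k is.
  -- Raising the constant 7 in `M` by one would already break it for k ≥ 2.
  bound-gap-middle : ∀ t k → 0ℤ ≤ℤ k → 0ℤ ≤ℤ t - 1ℤ → let q = k + t ; D = q - 1ℤ in
    1ℤ + estimate D t k (D * D) (q * q - + 5 * q + + 7) ≤ℤ sigmaBound (D + + 2 + t) k
  bound-gap-middle t k 0≤k 0≤s = ≤-via refl
    (0≤s ⊗ (lit 6 ⊗ 0≤k ⊗ 0≤s ⊕ lit 6 ⊗ 0≤s ⊗ 0≤s ⊕ lit 7 ⊗ 0≤k ⊕ lit 14 ⊗ 0≤s ⊕ lit 10) ⊕ lit 1)
    (expand t k)
    where
    expand : ∀ t k → let q = k + t ; D = q - 1ℤ ; N = D + + 2 + t ; s = t - 1ℤ in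
      (N - + 1) * (N - + 2) * (N - + 2) - + 2 * k * (+ 2 * N - + 5) + k * k * (k - + 1)
        - (1ℤ + ((D + 1ℤ) * (D * D) + t * (D * D) + k * (q * q - + 5 * q + + 7))) ≡
      s * (+ 6 * (k * s) + (+ 6 * (s * s) + (+ 7 * k + (+ 14 * s + + 10)))) + + 1
    expand = solve-∀

  -- For a fixed number of vertices the estimate grows with D, and 2 D ≤ n + k - 4;
  -- f is the slack of this inequality.
  bound-gap-high : ∀ D t k → 0ℤ ≤ℤ k → 0ℤ ≤ℤ D - 1ℤ → 0ℤ ≤ℤ k + t - D - + 2 →
    0ℤ ≤ℤ D + t - k → 0ℤ ≤ℤ D + t - + 2 →
    1ℤ + estimate D t k (D * D) ((D - 1ℤ) * (D - 1ℤ)) ≤ℤ sigmaBound (D + + 2 + t) k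
  bound-gap-high D t k 0≤k 0≤D-1 0≤f 0≤s 0≤r = *-cancelˡ-≤-pos _ _ (+ 4) (≤-via refl
    ((lit 6 ⊗ 0≤k ⊗ 0≤s ⊗ 0≤s ⊕ lit 3 ⊗ 0≤s ⊗ 0≤s ⊗ 0≤s ⊕ lit 3 ⊗ 0≤s ⊗ 0≤s ⊕ lit 4 ⊗ 0≤s
      ⊕ lit 4 ⊗ 0≤r ⊗ 0≤r ⊕ lit 12 ⊗ 0≤r)
      ⊕ (0≤r ⊕ lit 3) ⊗ 0≤f ⊗ (lit 4 ⊗ (0≤D-1 ⊕ lit 1) ⊕ 0≤f)
      ⊕ 0≤k ⊗ 0≤f ⊗ (lit 4 ⊗ 0≤D-1 ⊕ 0≤f))
    (expand D t k))
    where
    expand : ∀ D t k → let N = D + + 2 + t ; f = k + t - D - + 2 ; s = D + t - k ; r = D + t - + 2 in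
      + 4 * ((N - + 1) * (N - + 2) * (N - + 2) - + 2 * k * (+ 2 * N - + 5) + k * k * (k - + 1))
        - + 4 * (1ℤ + ((D + 1ℤ) * (D * D) + t * (D * D) + k * ((D - 1ℤ) * (D - 1ℤ)))) ≡
      + 6 * (k * (s * s)) + (+ 3 * (s * (s * s)) + (+ 3 * (s * s) + (+ 4 * s
        + (+ 4 * (r * r) + + 12 * r))))
      -- As r + 3 = n - 1, the estimate is (n - 1)D² + k(D - 1)². These two products are four times
      -- its growth when 2D is raised by f to n + k - 4; the factor 4 clears the halves. The
      -- remaining terms compare both sides at that value of D, with s = n - 2 - k and r = n - 4.
      + ((r + + 3) * (f * (+ 4 * (D - 1ℤ + + 1) + f)) + k * (f * (+ 4 * (D - 1ℤ) + f)))
    expand = solve-∀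

-- Finite sums of integers

δ : ∀ {n} → Fin n → Fin n → ℤ
δ i j = ⟦ does (i ≟ j) ⟧

δ-refl : ∀ {n} (i : Fin n) → δ i i ≡ 1ℤ
δ-refl i = cong ⟦_⟧ (Dec.dec-true (i ≟ i) refl)

δ-≢ : ∀ {n} {i j : Fin n} → i ≢ j → δ i j ≡ 0ℤ
δ-≢ {i = i} {j} i≢j = cong ⟦_⟧ (Dec.dec-false (i ≟ j) i≢j)

abstract
  ∑ : ∀ {n} → (Fin n → ℤ) → ℤ
  ∑ = sum

  ∑-cong : ∀ {n} {f g : Fin n → ℤ} → (∀ i → f i ≡ g i) → ∑ f ≡ ∑ g
  ∑-cong = Sum.sum-cong-≗

  ∑-mono-≤ : ∀ {n} {f g : Fin n → ℤ} → (∀ i → f i ≤ℤ g i) → ∑ f ≤ℤ ∑ g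
  ∑-mono-≤ {ℕ.zero} f≤g = ≤-refl
  ∑-mono-≤ {ℕ.suc n} f≤g = +-mono-≤ (f≤g zero) (∑-mono-≤ (f≤g ∘ suc))

  ∑-+ : ∀ {n} (f g : Fin n → ℤ) → ∑ (λ i → f i + g i) ≡ ∑ f + ∑ g
  ∑-+ = Sum.∑-distrib-+

  ∑-*ˡ : ∀ {n} c (f : Fin n → ℤ) → ∑ (λ i → c * f i) ≡ c * ∑ f
  ∑-*ˡ c f = sym (Sum.*-distribˡ-sum c f)

  ∑-comm : ∀ {n} (f : Fin n → Fin n → ℤ) → ∑ (λ i → ∑ (f i)) ≡ ∑ (λ j → ∑ (λ i → f i j))
  ∑-comm {n} f = Sum.∑-comm {n} {n} f

  ∑-punchIn : ∀ {n} (f : Fin (ℕ.suc n) → ℤ) i → ∑ f ≡ f i + ∑ (λ j → f (punchIn i j))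
  ∑-punchIn f i = Sum.sum-remove {i = i} f

  ∑-zero : ∀ n → ∑ {n} (λ _ → 0ℤ) ≡ 0ℤ
  ∑-zero ℕ.zero = refl
  ∑-zero (ℕ.suc n) = trans (+-identityˡ _) (∑-zero n)

  ∑-one : ∀ n → ∑ {n} (λ _ → 1ℤ) ≡ + n
  ∑-one ℕ.zero = refl
  ∑-one (ℕ.suc n) = cong (λ s → 1ℤ + s) (∑-one n)

  ∑-δ : ∀ {n} (w : Fin n) (f : Fin n → ℤ) → ∑ (λ i → δ w i * f i) ≡ f w
  ∑-δ {ℕ.suc n} zero f = begin
    1ℤ * f zero + ∑ {n} (λ _ → 0ℤ) ≡⟨ cong₂ _+_ (*-identityˡ (f zero)) (∑-zero n) ⟩
    f zero + 0ℤ                    ≡⟨ +-identityʳ (f zero) ⟩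
    f zero                         ∎
    where open ≡-Reasoning
  ∑-δ {ℕ.suc n} (suc w) f = trans (+-identityˡ _) (∑-δ w (f ∘ suc))

  pos-sum-tabulate : ∀ {n} (f : Fin n → ℕ) → + ListAction.sum (tabulate f) ≡ ∑ (λ i → + f i)
  pos-sum-tabulate {ℕ.zero} f = refl
  pos-sum-tabulate {ℕ.suc n} f = cong (λ s → + f zero + s) (pos-sum-tabulate (f ∘ suc))

∑-nonneg : ∀ {n} {f : Fin n → ℤ} → (∀ i → 0ℤ ≤ℤ f i) → 0ℤ ≤ℤ ∑ f
∑-nonneg {n} {f} 0≤f = subst (_≤ℤ ∑ f) (∑-zero n) (∑-mono-≤ 0≤f)

term≤∑ : ∀ {n} {f : Fin n → ℤ} → (∀ i → 0ℤ ≤ℤ f i) → ∀ i → f i ≤ℤ ∑ f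
term≤∑ {f = f} 0≤f i = subst (_≤ℤ ∑ f) (∑-δ i f) (∑-mono-≤ lower)
  where
  lower : ∀ b → δ i b * f b ≤ℤ f b
  lower b with does (i ≟ b)
  ... | true  = ≤-reflexive (*-identityˡ (f b))
  ... | false = 0≤f b

two-terms≤∑ : ∀ {n} {f : Fin n → ℤ} → (∀ i → 0ℤ ≤ℤ f i) → ∀ {i j} → i ≢ j → f i + f j ≤ℤ ∑ f
two-terms≤∑ {f = f} 0≤f {i} {j} i≢j = subst (_≤ℤ ∑ f)
  (trans (∑-+ (λ b → δ i b * f b) (λ b → δ j b * f b)) (cong₂ _+_ (∑-δ i f) (∑-δ j f)))
  (∑-mono-≤ lower)
  where
  lower : ∀ b → δ i b * f b + δ j b * f b ≤ℤ f b
  lower b with i ≟ b | j ≟ b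
  ... | yes refl | yes refl = contradiction refl i≢j
  ... | yes _ | no _ = ≤-reflexive (trans (+-identityʳ _) (*-identityˡ (f b)))
  ... | no _ | yes _ = ≤-reflexive (trans (+-identityˡ _) (*-identityˡ (f b)))
  ... | no _ | no _ = 0≤f b

∑∑ : ∀ {n} → (Fin n → Fin n → ℤ) → ℤ
∑∑ f = ∑ (λ i → ∑ (f i))

∑∑-cong : ∀ {n} {f g : Fin n → Fin n → ℤ} → (∀ i j → f i j ≡ g i j) → ∑∑ f ≡ ∑∑ g
∑∑-cong f≡g = ∑-cong (λ i → ∑-cong (f≡g i))

∑∑-mono-≤ : ∀ {n} {f g : Fin n → Fin n → ℤ} → (∀ i j → f i j ≤ℤ g i j) → ∑∑ f ≤ℤ ∑∑ g
∑∑-mono-≤ f≤g = ∑-mono-≤ (λ i → ∑-mono-≤ (f≤g i))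

∑∑-+ : ∀ {n} (f g : Fin n → Fin n → ℤ) → ∑∑ (λ i j → f i j + g i j) ≡ ∑∑ f + ∑∑ g
∑∑-+ f g = trans (∑-cong (λ i → ∑-+ (f i) (g i))) (∑-+ (λ i → ∑ (f i)) (λ i → ∑ (g i)))

∑∑-*ˡ : ∀ {n} c (f : Fin n → Fin n → ℤ) → ∑∑ (λ i j → c * f i j) ≡ c * ∑∑ f
∑∑-*ˡ c f = trans (∑-cong (λ i → ∑-*ˡ c (f i))) (∑-*ˡ c (λ i → ∑ (f i)))

-- Edge sums and degrees as integer sums

pos-ΣV : ∀ {n} (f : Fin n → ℕ) → + ΣV f ≡ ∑ (λ i → + f i)
pos-ΣV f = trans (cong (λ l → + ListAction.sum l) (map-tabulate id f)) (pos-sum-tabulate f)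

ΣV-cong : ∀ {n} {f g : Fin n → ℕ} → (∀ i → f i ≡ g i) → ΣV f ≡ ΣV g
ΣV-cong {n} f≡g = cong ListAction.sum (map-cong f≡g (allFin n))

-- Checking ΣE-unfold first lets Agda infer the left-hand side of ΣE-summand,
-- which is local to the definition of ΣE and has no name here.
mutual
  ΣE-unfold : ∀ {n} (G : Graph n) f →
    ΣE G f ≡ ΣV (λ i → ΣV λ j → if (toℕ i <ᵇ toℕ j) ∧ adj G i j then f i j else 0)
  ΣE-unfold G f = ΣV-cong λ i → ΣV-cong λ j → ΣE-summand G f i j

  ΣE-summand : ∀ {n} (G : Graph n) f (i j : Fin n) →
    _ ≡ (if (toℕ i <ᵇ toℕ j) ∧ adj G i j then f i j else 0)
  ΣE-summand G f i j with (toℕ i <ᵇ toℕ j) ∧ adj G i j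
  ... | true = refl
  ... | false = refl

pos-if : ∀ b m → + (if b then m else 0) ≡ ⟦ b ⟧ * + m
pos-if true m = sym (*-identityˡ (+ m))
pos-if false m = refl

pos-ΣE : ∀ {n} (G : Graph n) f →
  + ΣE G f ≡ ∑∑ (λ i j → ⟦ (toℕ i <ᵇ toℕ j) ∧ adj G i j ⟧ * + f i j)
pos-ΣE G f = begin
  + ΣE G f ≡⟨ cong +_ (ΣE-unfold G f) ⟩
  + ΣV (λ i → ΣV (h i)) ≡⟨ pos-ΣV _ ⟩
  ∑ (λ i → + ΣV (h i)) ≡⟨ ∑-cong (λ i → pos-ΣV (h i)) ⟩
  ∑∑ (λ i j → + h i j) ≡⟨ ∑∑-cong (λ i j → pos-if ((toℕ i <ᵇ toℕ j) ∧ adj G i j) (f i j)) ⟩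
  ∑∑ (λ i j → ⟦ (toℕ i <ᵇ toℕ j) ∧ adj G i j ⟧ * + f i j) ∎
  where
  open ≡-Reasoning
  h = λ i j → if (toℕ i <ᵇ toℕ j) ∧ adj G i j then f i j else 0

<ᵇ-true : ∀ {m n} → m ℕ.< n → (m <ᵇ n) ≡ true
<ᵇ-true {m} {n} m<n = Dec.dec-true (m ℕ.<? n) m<n

<ᵇ-false : ∀ {m n} → n ℕ.≤ m → (m <ᵇ n) ≡ false
<ᵇ-false {m} {n} n≤m = Dec.dec-false (m ℕ.<? n) (ℕ.≤⇒≯ n≤m)

adj-orient : ∀ {n} (G : Graph n) i j →
  ⟦ (toℕ i <ᵇ toℕ j) ∧ adj G i j ⟧ + ⟦ (toℕ j <ᵇ toℕ i) ∧ adj G j i ⟧ ≡ ⟦ adj G i j ⟧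
adj-orient G i j with <-cmp i j
... | tri< i<j _ _ rewrite <ᵇ-true i<j | <ᵇ-false (ℕ.<⇒≤ i<j) = +-identityʳ _
... | tri≈ _ refl _ rewrite <ᵇ-false (ℕ.≤-refl {toℕ i}) | irrefl G i = refl
... | tri> _ _ j<i rewrite <ᵇ-true j<i | <ᵇ-false (ℕ.<⇒≤ j<i) | adj-sym G i j = +-identityˡ _

-- Adding the transposed sum replaces the pairs with i < j by all ordered pairs. Edge sums are
-- handled in this doubled form until a factor 2 is cancelled.
handshake : ∀ {n} (G : Graph n) f → (∀ i j → f i j ≡ f j i) →
  + 2 * + ΣE G f ≡ ∑∑ (λ i j → ⟦ adj G i j ⟧ * + f i j)
handshake G f f-sym = begin
  + 2 * + ΣE G f ≡⟨ double (+ ΣE G f) ⟩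
  + ΣE G f + + ΣE G f ≡⟨ cong₂ _+_ (pos-ΣE G f) (trans (pos-ΣE G f) (∑-comm g)) ⟩
  ∑∑ g + ∑∑ (λ i j → g j i) ≡⟨ ∑∑-+ g (λ i j → g j i) ⟨
  ∑∑ (λ i j → o i j * + f i j + o j i * + f j i) ≡⟨ ∑∑-cong merge ⟩
  ∑∑ (λ i j → ⟦ adj G i j ⟧ * + f i j) ∎
  where
  open ≡-Reasoning
  o = λ i j → ⟦ (toℕ i <ᵇ toℕ j) ∧ adj G i j ⟧
  g = λ i j → o i j * + f i j
  double : ∀ z → + 2 * z ≡ z + z
  double = solve-∀
  merge : ∀ i j → o i j * + f i j + o j i * + f j i ≡ ⟦ adj G i j ⟧ * + f i j
  merge i j = begin
    o i j * + f i j + o j i * + f j i ≡⟨ cong (λ z → o i j * + f i j + o j i * + z) (f-sym j i) ⟩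
    o i j * + f i j + o j i * + f i j ≡⟨ *-distribʳ-+ (+ f i j) (o i j) (o j i) ⟨
    (o i j + o j i) * + f i j         ≡⟨ cong (_* + f i j) (adj-orient G i j) ⟩
    ⟦ adj G i j ⟧ * + f i j           ∎

pos-sq : ∀ m n → + (ℕ.∣ m - n ∣ ℕ.^ 2) ≡ (+ m - + n) * (+ m - + n)
pos-sq m n = begin
  + (ℕ.∣ m - n ∣ ℕ.^ 2)         ≡⟨ cong (λ k → + (k ℕ.^ 2)) (trans (∣-∣≡∣⊖∣ m n) (cong ∣_∣ (sym (m-n≡m⊖n m n)))) ⟩
  + (∣ + m - + n ∣ ℕ.^ 2)       ≡⟨ abs-sq (+ m - + n) ⟩
  (+ m - + n) * (+ m - + n)     ∎
  where
  open ≡-Reasoning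
  ∣-∣≡∣⊖∣ : ∀ m n → ℕ.∣ m - n ∣ ≡ ∣ m ⊖ n ∣
  ∣-∣≡∣⊖∣ ℕ.zero ℕ.zero = refl
  ∣-∣≡∣⊖∣ ℕ.zero (ℕ.suc n) = refl
  ∣-∣≡∣⊖∣ (ℕ.suc m) ℕ.zero = refl
  ∣-∣≡∣⊖∣ (ℕ.suc m) (ℕ.suc n) = trans (∣-∣≡∣⊖∣ m n) (cong ∣_∣ (sym ([1+m]⊖[1+n]≡m⊖n m n)))
  abs-sq : ∀ i → + (∣ i ∣ ℕ.^ 2) ≡ i * i
  abs-sq (+ m) = trans (cong (λ k → + (m ℕ.* k)) (ℕ.*-identityʳ m)) (pos-* m m)
  abs-sq -[1+ m ] = cong (λ k → + (ℕ.suc m ℕ.* k)) (ℕ.*-identityʳ (ℕ.suc m))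

0≤⟦_⟧ : ∀ b → 0ℤ ≤ℤ ⟦ b ⟧
0≤⟦ true ⟧ = lit 1
0≤⟦ false ⟧ = ≤-refl

⟦⟧≤1 : ∀ b → ⟦ b ⟧ ≤ℤ 1ℤ
⟦⟧≤1 true = ≤-refl
⟦⟧≤1 false = lit 1

adj⇒≢ : ∀ {n} (G : Graph n) {i j} → adj G i j ≡ true → i ≢ j
adj⇒≢ G {i} i∼i refl with trans (sym i∼i) (irrefl G i)
... | ()

pos-deg : ∀ {n} (G : Graph n) i → + deg G i ≡ ∑ (λ j → ⟦ adj G i j ⟧)
pos-deg G i = trans (pos-ΣV (λ j → if adj G i j then 1 else 0)) (∑-cong (λ j → indicator (adj G i j)))
  where
  indicator : ∀ b → + (if b then 1 else 0) ≡ ⟦ b ⟧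
  indicator true = refl
  indicator false = refl

-- Edges avoiding a vertex

module Off {n : ℕ} (G : Graph n) (w : Fin n) where

  -- The adjacency of G - w, kept on `Fin n` with w isolated, so that no vertex has to be
  -- renumbered.
  off : Fin n → Fin n → Bool
  off i j = not (does (w ≟ i)) ∧ not (does (w ≟ j)) ∧ adj G i j

  d x α : Fin n → ℤ
  d i = + deg G i
  x i = ∑ (λ j → ⟦ off i j ⟧)
  α i = ⟦ adj G w i ⟧

  record OffEdge (i j : Fin n) : Set where
    constructor offEdge
    field
      w≢i : w ≢ i
      w≢j : w ≢ j
      i∼j : adj G i j ≡ true

  off-view : ∀ i j → off i j ≡ false ⊎ (off i j ≡ true × OffEdge i j)
  off-view i j with w ≟ i | w ≟ j | adj G i j in eq
  ... | yes _  | _       | _     = inj₁ refl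
  ... | no _   | yes _   | _     = inj₁ refl
  ... | no _   | no _    | false = inj₁ refl
  ... | no w≢i | no w≢j  | true  = inj₂ (refl , offEdge w≢i w≢j eq)

  off-edge : ∀ {i j} → OffEdge i j → off i j ≡ true
  off-edge {i} {j} (offEdge w≢i w≢j i∼j)
    rewrite Dec.dec-false (w ≟ i) w≢i | Dec.dec-false (w ≟ j) w≢j = i∼j

  off-sym : ∀ i j → off i j ≡ off j i
  off-sym i j rewrite adj-sym G i j with does (w ≟ i) | does (w ≟ j)
  ... | true  | true  = refl
  ... | true  | false = refl
  ... | false | true  = refl
  ... | false | false = refl

  off-irrefl : ∀ i → off i i ≡ false
  off-irrefl i rewrite irrefl G i | ∧-zeroʳ (not (does (w ≟ i))) = ∧-zeroʳ (not (does (w ≟ i)))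

  adj-split : ∀ i j (f : ℤ) → ⟦ adj G i j ⟧ * f ≡
    ⟦ off i j ⟧ * f + (δ w i * (⟦ adj G i j ⟧ * f) + δ w j * (⟦ adj G i j ⟧ * f))
  adj-split i j f with w ≟ i | w ≟ j
  ... | yes refl | yes refl rewrite irrefl G i = refl
  ... | yes _ | no _ = lemma (⟦ adj G i j ⟧ * f) f
    where
    lemma : ∀ y f → y ≡ 0ℤ * f + (1ℤ * y + 0ℤ * y)
    lemma = solve-∀
  ... | no _ | yes _ = lemma (⟦ adj G i j ⟧ * f) f
    where
    lemma : ∀ y f → y ≡ 0ℤ * f + (0ℤ * y + 1ℤ * y)
    lemma = solve-∀
  ... | no _ | no _ = lemma (⟦ adj G i j ⟧ * f)
    where
    lemma : ∀ y → y ≡ y + (0ℤ * y + 0ℤ * y)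
    lemma = solve-∀

  ∑-adj : ∀ (f : Fin n → Fin n → ℤ) → (∀ i j → f i j ≡ f j i) →
    ∑∑ (λ i j → ⟦ adj G i j ⟧ * f i j) ≡
    ∑∑ (λ i j → ⟦ off i j ⟧ * f i j) + + 2 * ∑ (λ j → α j * f w j)
  ∑-adj f f-sym = begin
    ∑∑ g
      ≡⟨ ∑∑-cong (λ i j → adj-split i j (f i j)) ⟩
    ∑∑ (λ i j → ⟦ off i j ⟧ * f i j + (δ w i * g i j + δ w j * g i j))
      ≡⟨ ∑∑-+ (λ i j → ⟦ off i j ⟧ * f i j) (λ i j → δ w i * g i j + δ w j * g i j) ⟩
    S + ∑∑ (λ i j → δ w i * g i j + δ w j * g i j)
      ≡⟨ cong (λ z → S + z) (∑∑-+ (λ i j → δ w i * g i j) (λ i j → δ w j * g i j)) ⟩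
    S + (∑∑ (λ i j → δ w i * g i j) + ∑∑ (λ i j → δ w j * g i j))
      ≡⟨ cong₂ (λ y z → S + (y + z)) rows columns ⟩
    S + (R + R)
      ≡⟨ double S R ⟩
    S + + 2 * R ∎
    where
    open ≡-Reasoning
    g = λ i j → ⟦ adj G i j ⟧ * f i j
    S = ∑∑ (λ i j → ⟦ off i j ⟧ * f i j)
    R = ∑ (λ j → α j * f w j)
    double : ∀ S R → S + (R + R) ≡ S + + 2 * R
    double = solve-∀
    rows : ∑∑ (λ i j → δ w i * g i j) ≡ R
    rows = trans (∑-cong (λ i → ∑-*ˡ (δ w i) (g i))) (∑-δ w (λ i → ∑ (g i)))
    columns : ∑∑ (λ i j → δ w j * g i j) ≡ R
    columns = trans (∑-cong (λ i → ∑-δ w (g i)))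
      (∑-cong (λ i → cong₂ (λ b z → ⟦ b ⟧ * z) (adj-sym G i w) (f-sym i w)))

  ∑-off-sym : ∀ j → ∑ (λ i → ⟦ off i j ⟧) ≡ x j
  ∑-off-sym j = ∑-cong (λ i → cong ⟦_⟧ (off-sym i j))

  -- A term c(i) x(i) is spread over the x(i) edges of G - w at i. This serves twice: for the
  -- corrections from the edges at w, and for counting the pendent ends of edges of G - w.
  ∑∑-off-* : ∀ (c : Fin n → ℤ) → ∑∑ (λ i j → ⟦ off i j ⟧ * (c i + c j)) ≡ + 2 * ∑ (λ i → c i * x i)
  ∑∑-off-* c = begin
    ∑∑ (λ i j → ⟦ off i j ⟧ * (c i + c j))
      ≡⟨ ∑∑-cong (λ i j → expand ⟦ off i j ⟧ (c i) (c j)) ⟩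
    ∑∑ (λ i j → c i * ⟦ off i j ⟧ + c j * ⟦ off i j ⟧)
      ≡⟨ ∑∑-+ (λ i j → c i * ⟦ off i j ⟧) (λ i j → c j * ⟦ off i j ⟧) ⟩
    ∑∑ (λ i j → c i * ⟦ off i j ⟧) + ∑∑ (λ i j → c j * ⟦ off i j ⟧)
      ≡⟨ cong₂ _+_ left (trans (∑-comm (λ i j → c j * ⟦ off i j ⟧)) right) ⟩
    R + R ≡⟨ double R ⟩
    + 2 * R ∎
    where
    open ≡-Reasoning
    R = ∑ (λ i → c i * x i)
    expand : ∀ o a b → o * (a + b) ≡ a * o + b * o
    expand = solve-∀
    double : ∀ R → R + R ≡ + 2 * R
    double = solve-∀
    left : ∑∑ (λ i j → c i * ⟦ off i j ⟧) ≡ R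
    left = ∑-cong (λ i → ∑-*ˡ (c i) (λ j → ⟦ off i j ⟧))
    right : ∑ (λ j → ∑ (λ i → c j * ⟦ off i j ⟧)) ≡ R
    right = ∑-cong (λ j → trans (∑-*ˡ (c j) (λ i → ⟦ off i j ⟧)) (cong (λ z → c j * z) (∑-off-sym j)))

  d≡x+α : ∀ {i} → w ≢ i → d i ≡ x i + α i
  d≡x+α {i} w≢i = begin
    d i ≡⟨ pos-deg G i ⟩
    ∑ (λ j → ⟦ adj G i j ⟧) ≡⟨ ∑-cong split ⟩
    ∑ (λ j → ⟦ off i j ⟧ + δ w j * ⟦ adj G i j ⟧)
      ≡⟨ ∑-+ (λ j → ⟦ off i j ⟧) (λ j → δ w j * ⟦ adj G i j ⟧) ⟩
    x i + ∑ (λ j → δ w j * ⟦ adj G i j ⟧)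
      ≡⟨ cong (λ z → x i + z) (trans (∑-δ w (λ j → ⟦ adj G i j ⟧)) (cong ⟦_⟧ (adj-sym G i w))) ⟩
    x i + α i ∎
    where
    open ≡-Reasoning
    split : ∀ j → ⟦ adj G i j ⟧ ≡ ⟦ off i j ⟧ + δ w j * ⟦ adj G i j ⟧
    split j rewrite Dec.dec-false (w ≟ i) w≢i with does (w ≟ j)
    ... | true  = sym (trans (+-identityˡ _) (*-identityˡ _))
    ... | false = sym (+-identityʳ _)

  ∑x : ∑ x ≡ + 2 * + size G - + 2 * d w
  ∑x = begin
    ∑ x ≡⟨ ∑∑-cong (λ i j → *-identityʳ ⟦ off i j ⟧) ⟨
    ∑∑ (λ i j → ⟦ off i j ⟧ * 1ℤ) ≡⟨ rearrange _ _ ⟩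
    ∑∑ (λ i j → ⟦ off i j ⟧ * 1ℤ) + + 2 * ∑ (λ j → α j * 1ℤ) - + 2 * ∑ (λ j → α j * 1ℤ)
      ≡⟨ cong₂ (λ y z → y - + 2 * z) 
           (sym (trans (handshake G (λ _ _ → 1) (λ _ _ → refl)) (∑-adj (λ _ _ → 1ℤ) (λ _ _ → refl))))
           (trans (∑-cong (λ j → *-identityʳ (α j))) (sym (pos-deg G w))) ⟩
    + 2 * + size G - + 2 * d w ∎
    where
    open ≡-Reasoning
    rearrange : ∀ a b → a ≡ a + + 2 * b - + 2 * b
    rearrange = solve-∀

  wt : ℤ → Fin n → Fin n → ℤ
  wt D i j = weight D (α i) (α j) (x i) (x j)

  module _ (D : ℤ) (dw : d w ≡ D + 1ℤ) where

    private
      c : Fin n → ℤ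
      c i = α i * (x i - + 2 * D)

      sq : Fin n → Fin n → ℤ
      sq i j = (d i - d j) * (d i - d j)

      at-w : ∀ j → α j * sq w j ≡ D * D * α j + c j * x j
      at-w j with adj G w j in eq
      ... | false = zeros (sq w j) D (x j)
        where
        zeros : ∀ s D y → 0ℤ * s ≡ D * D * 0ℤ + 0ℤ * (y - + 2 * D) * y
        zeros = solve-∀
      ... | true = begin
        1ℤ * sq w j ≡⟨ cong₂ (λ y z → 1ℤ * ((y - z) * (y - z))) dw 
                          (trans (d≡x+α (adj⇒≢ G eq)) (cong (λ b → x j + ⟦ b ⟧) eq)) ⟩
        1ℤ * ((D + 1ℤ - (x j + 1ℤ)) * (D + 1ℤ - (x j + 1ℤ))) ≡⟨ expand D (x j) ⟩
        D * D * 1ℤ + 1ℤ * (x j - + 2 * D) * x j ∎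
        where
        open ≡-Reasoning
        expand : ∀ D y → 1ℤ * ((D + 1ℤ - (y + 1ℤ)) * (D + 1ℤ - (y + 1ℤ))) ≡
                         D * D * 1ℤ + 1ℤ * (y - + 2 * D) * y
        expand = solve-∀

      off-w : ∀ i j → ⟦ off i j ⟧ * sq i j + ⟦ off i j ⟧ * (c i + c j) ≡ ⟦ off i j ⟧ * wt D i j
      off-w i j with off-view i j
      ... | inj₁ eq rewrite eq = refl
      ... | inj₂ (eq , offEdge w≢i w≢j _) rewrite eq = begin
        1ℤ * sq i j + 1ℤ * (c i + c j)
          ≡⟨ cong₂ (λ y z → 1ℤ * ((y - z) * (y - z)) + 1ℤ * (c i + c j)) (d≡x+α w≢i) (d≡x+α w≢j) ⟩
        1ℤ * ((x i + α i - (x j + α j)) * (x i + α i - (x j + α j))) + 1ℤ * (c i + c j)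
          ≡⟨ regroup (c i) (c j) _ ⟩
        1ℤ * (c i + c j + (x i + α i - (x j + α j)) * (x i + α i - (x j + α j)))
          ≡⟨ cong (λ z → 1ℤ * z) (weight-def D (α i) (α j) (x i) (x j)) ⟨
        1ℤ * wt D i j ∎
        where
        open ≡-Reasoning
        regroup : ∀ a b s → 1ℤ * s + 1ℤ * (a + b) ≡ 1ℤ * (a + b + s)
        regroup = solve-∀

    sigma-expansion : + 2 * + sigma G ≡
      + 2 * ((D + 1ℤ) * (D * D)) + ∑∑ (λ i j → ⟦ off i j ⟧ * wt D i j)
    sigma-expansion = begin
      + 2 * + sigma G
        ≡⟨ handshake G (λ i j → ℕ.∣ deg G i - deg G j ∣ ℕ.^ 2)
             (λ i j → cong (ℕ._^ 2) (ℕ.∣-∣-comm (deg G i) (deg G j))) ⟩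
      ∑∑ (λ i j → ⟦ adj G i j ⟧ * + (ℕ.∣ deg G i - deg G j ∣ ℕ.^ 2))
        ≡⟨ ∑∑-cong (λ i j → cong (λ z → ⟦ adj G i j ⟧ * z) (pos-sq (deg G i) (deg G j))) ⟩
      ∑∑ (λ i j → ⟦ adj G i j ⟧ * sq i j)
        ≡⟨ ∑-adj sq (λ i j → swap (d i) (d j)) ⟩
      S + + 2 * ∑ (λ j → α j * sq w j)
        ≡⟨ cong (λ z → S + + 2 * z) star ⟩
      S + + 2 * (D * D * (D + 1ℤ) + C)
        ≡⟨ regroup S D C ⟩
      + 2 * ((D + 1ℤ) * (D * D)) + (S + + 2 * C)
        ≡⟨ cong (λ z → + 2 * ((D + 1ℤ) * (D * D)) + (S + z)) (∑∑-off-* c) ⟨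
      + 2 * ((D + 1ℤ) * (D * D)) + (S + ∑∑ (λ i j → ⟦ off i j ⟧ * (c i + c j)))
        ≡⟨ cong (λ z → + 2 * ((D + 1ℤ) * (D * D)) + z)
             (trans (sym (∑∑-+ (λ i j → ⟦ off i j ⟧ * sq i j) (λ i j → ⟦ off i j ⟧ * (c i + c j)))) (∑∑-cong off-w)) ⟩
      + 2 * ((D + 1ℤ) * (D * D)) + ∑∑ (λ i j → ⟦ off i j ⟧ * wt D i j) ∎
      where
      open ≡-Reasoning
      S = ∑∑ (λ i j → ⟦ off i j ⟧ * sq i j)
      C = ∑ (λ j → c j * x j)
      swap : ∀ a b → (a - b) * (a - b) ≡ (b - a) * (b - a)
      swap = solve-∀
      regroup : ∀ S D C → S + + 2 * (D * D * (D + 1ℤ) + C) ≡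
                          + 2 * ((D + 1ℤ) * (D * D)) + (S + + 2 * C)
      regroup = solve-∀
      star : ∑ (λ j → α j * sq w j) ≡ D * D * (D + 1ℤ) + C
      star = begin
        ∑ (λ j → α j * sq w j) ≡⟨ ∑-cong at-w ⟩
        ∑ (λ j → D * D * α j + c j * x j) ≡⟨ ∑-+ (λ j → D * D * α j) (λ j → c j * x j) ⟩
        ∑ (λ j → D * D * α j) + C ≡⟨ cong (λ z → z + C) (∑-*ˡ (D * D) α) ⟩
        D * D * ∑ α + C ≡⟨ cong (λ z → D * D * z + C) (trans (sym (pos-deg G w)) dw) ⟩
        D * D * (D + 1ℤ) + C ∎

  x-nonneg : ∀ i → 0ℤ ≤ℤ x i
  x-nonneg i = ∑-nonneg (λ j → 0≤⟦ off i j ⟧)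

  off≤x : ∀ i j → ⟦ off i j ⟧ ≤ℤ x i
  off≤x i j = term≤∑ (λ j → 0≤⟦ off i j ⟧) j

  off+off≤x : ∀ i {j l} → j ≢ l → ⟦ off i j ⟧ + ⟦ off i l ⟧ ≤ℤ x i
  off+off≤x i = two-terms≤∑ (λ j → 0≤⟦ off i j ⟧)

  xw≡0 : x w ≡ 0ℤ
  xw≡0 = trans (∑-cong vanish) (∑-zero n)
    where
    vanish : ∀ j → ⟦ off w j ⟧ ≡ 0ℤ
    vanish j rewrite Dec.dec-true (w ≟ w) refl = refl

  module _ {i j : Fin n} (e : OffEdge i j) where
    open OffEdge e

    i≢j : i ≢ j
    i≢j = adj⇒≢ G i∼j

    OffEdge-sym : OffEdge j i
    OffEdge-sym = offEdge w≢j w≢i (trans (adj-sym G j i) i∼j)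

    1≤x : 1ℤ ≤ℤ x i
    1≤x = subst (λ b → ⟦ b ⟧ ≤ℤ x i) (off-edge e) (off≤x i j)

    -- The edges of G - w meeting i or j number x(i) + x(j) - 1, the edge ij being shared. The
    -- degree sum counts each of them twice.
    x+x≤ : + 2 * (x i + x j - 1ℤ) ≤ℤ ∑ x
    x+x≤ = begin
      + 2 * (x i + x j - 1ℤ) ≡⟨ regroup (x i) (x j) ⟩
      x i + x j + (x i - 1ℤ + (x j - 1ℤ)) ≡⟨ cong₂ _+_ (cong₂ _+_ (∑-off-sym i) (∑-off-sym j))
                                                (cong₂ _+_ (∑-δ i (λ _ → x i - 1ℤ)) (∑-δ j (λ _ → x j - 1ℤ))) ⟨
      ∑ f + ∑ g + (∑ h + ∑ k) ≡⟨ cong₂ _+_ (∑-+ f g) (∑-+ h k) ⟨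
      ∑ (λ a → f a + g a) + ∑ (λ a → h a + k a) ≡⟨ ∑-+ (λ a → f a + g a) (λ a → h a + k a) ⟨
      ∑ (λ a → f a + g a + (h a + k a)) ≤⟨ ∑-mono-≤ lower ⟩
      ∑ x ∎
      where
      open ≤-Reasoning
      f = λ a → ⟦ off a i ⟧
      g = λ a → ⟦ off a j ⟧
      -- At a = i and a = j the terms `f` and `g` count only the edge ij; `h` and `k` top them up to
      -- the full degree.
      h = λ a → δ i a * (x i - 1ℤ)
      k = λ a → δ j a * (x j - 1ℤ)
      regroup : ∀ a b → + 2 * (a + b - 1ℤ) ≡ a + b + (a - 1ℤ + (b - 1ℤ))
      regroup = solve-∀
      lower : ∀ a → f a + g a + (h a + k a) ≤ℤ x a
      lower a with i ≟ a | j ≟ a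
      ... | yes refl | yes refl = contradiction refl i≢j
      ... | yes refl | no _ rewrite off-irrefl i | off-edge e = ≤-reflexive (cancel (x i) (x j))
        where
        cancel : ∀ a b → 0ℤ + 1ℤ + (1ℤ * (a - 1ℤ) + 0ℤ * (b - 1ℤ)) ≡ a
        cancel = solve-∀
      ... | no _ | yes refl rewrite off-irrefl j | off-edge OffEdge-sym = ≤-reflexive (cancel (x i) (x j))
        where
        cancel : ∀ a b → 1ℤ + 0ℤ + (0ℤ * (a - 1ℤ) + 1ℤ * (b - 1ℤ)) ≡ b
        cancel = solve-∀
      ... | no _ | no _ = subst (_≤ℤ x a) (sym (cancel (f a + g a) (x i) (x j))) (off+off≤x a i≢j)
        where
        cancel : ∀ s a b → s + (0ℤ * (a - 1ℤ) + 0ℤ * (b - 1ℤ)) ≡ s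
        cancel = solve-∀

  module _ (u : Fin n) where

    Touching : Set
    Touching = ∀ {i j} → OffEdge i j → u ≡ i ⊎ u ≡ j

    -- The vertex u and its neighbours account for 2x(u) in the degree sum. An edge ij missing u
    -- adds at least one more, since i then has the neighbour j besides possibly u.
    full-degree⇒touching : ∑ x ≡ + 2 * x u → Touching
    full-degree⇒touching ∑x≡2xu {i} {j} e with u ≟ i | u ≟ j
    ... | yes u≡i | _ = inj₁ u≡i
    ... | no _ | yes u≡j = inj₂ u≡j
    ... | no u≢i | no u≢j = contradiction excess (1+i≰i (+ 2 * x u))
      where
      f = λ a → ⟦ off a u ⟧
      g = λ a → δ u a * x u
      h = λ a → δ i a * 1ℤ
      lower : ∀ a → f a + (g a + h a) ≤ℤ x a
      lower a with u ≟ a | i ≟ a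
      ... | yes refl | yes refl = contradiction refl u≢i
      ... | yes refl | no _ rewrite off-irrefl u = ≤-reflexive (cancel (x u))
        where
        cancel : ∀ y → 0ℤ + (1ℤ * y + 0ℤ * 1ℤ) ≡ y
        cancel = solve-∀
      ... | no _ | yes refl = subst (_≤ℤ x a)
        (trans (cong (λ b → ⟦ off i u ⟧ + ⟦ b ⟧) (off-edge e)) (cancel ⟦ off i u ⟧ (x u)))
        (off+off≤x i u≢j)
        where
        cancel : ∀ s y → s + 1ℤ ≡ s + (0ℤ * y + 1ℤ * 1ℤ)
        cancel = solve-∀
      ... | no _ | no _ = subst (_≤ℤ x a) (cancel ⟦ off a u ⟧ (x u)) (off≤x a u)
        where
        cancel : ∀ s y → s ≡ s + (0ℤ * y + 0ℤ * 1ℤ)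
        cancel = solve-∀
      excess : 1ℤ + + 2 * x u ≤ℤ + 2 * x u
      excess = begin
        1ℤ + + 2 * x u ≡⟨ regroup (x u) ⟩
        x u + (x u + 1ℤ) ≡⟨ cong₂ _+_ (∑-off-sym u) (cong₂ _+_ (∑-δ u (λ _ → x u)) (∑-δ i (λ _ → 1ℤ))) ⟨
        ∑ f + (∑ g + ∑ h) ≡⟨ cong (λ z → ∑ f + z) (∑-+ g h) ⟨
        ∑ f + ∑ (λ a → g a + h a) ≡⟨ ∑-+ f (λ a → g a + h a) ⟨
        ∑ (λ a → f a + (g a + h a)) ≤⟨ ∑-mono-≤ lower ⟩
        ∑ x ≡⟨ ∑x≡2xu ⟩
        + 2 * x u ∎
        where
        open ≤-Reasoning
        regroup : ∀ y → 1ℤ + + 2 * y ≡ y + (y + 1ℤ)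
        regroup = solve-∀

    touching⇒full-degree : Touching → ∑ x ≡ + 2 * x u
    touching⇒full-degree touching = begin
      ∑ x ≡⟨ ∑-cong split ⟩
      ∑ (λ a → ⟦ off a u ⟧ + δ u a * x u) ≡⟨ ∑-+ (λ a → ⟦ off a u ⟧) (λ a → δ u a * x u) ⟩
      ∑ (λ a → ⟦ off a u ⟧) + ∑ (λ a → δ u a * x u) ≡⟨ cong₂ _+_ (∑-off-sym u) (∑-δ u (λ _ → x u)) ⟩
      x u + x u ≡⟨ double (x u) ⟩
      + 2 * x u ∎
      where
      open ≡-Reasoning
      double : ∀ y → y + y ≡ + 2 * y
      double = solve-∀
      only-u : ∀ {a} → u ≢ a → ∀ b → ⟦ off a b ⟧ ≡ δ u b * ⟦ off a b ⟧
      only-u {a} u≢a b with off-view a b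
      ... | inj₁ eq rewrite eq = sym (*-zeroʳ (δ u b))
      ... | inj₂ (eq , e) with touching e
      ...   | inj₁ u≡a = contradiction u≡a u≢a
      ...   | inj₂ refl rewrite δ-refl u = sym (*-identityˡ _)
      split : ∀ a → x a ≡ ⟦ off a u ⟧ + δ u a * x u
      split a with u ≟ a
      ... | yes refl rewrite off-irrefl u = sym (trans (+-identityˡ _) (*-identityˡ _))
      ... | no u≢a = trans (trans (∑-cong (only-u u≢a)) (∑-δ u (λ b → ⟦ off a b ⟧))) (sym (+-identityʳ _))

  -- Otherwise w, i and the neighbours of w would be 2 + d(w) distinct vertices.
  dominating : + n ≡ 1ℤ + d w → ∀ {i} → w ≢ i → adj G w i ≡ true
  dominating n≡1+dw {i} w≢i with adj G w i in eq
  ... | true = refl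
  ... | false = contradiction excess (1+i≰i (+ n))
    where
    f = λ b → δ w b * 1ℤ
    g = λ b → δ i b * 1ℤ
    upper : ∀ b → f b + g b + α b ≤ℤ 1ℤ
    upper b with w ≟ b | i ≟ b
    ... | yes refl | yes refl = contradiction refl w≢i
    ... | yes refl | no _ rewrite irrefl G w = ≤-refl
    ... | no _ | yes refl rewrite eq = ≤-refl
    ... | no _ | no _ = subst (_≤ℤ 1ℤ) (sym (+-identityˡ (α b))) (⟦⟧≤1 (adj G w b))
    excess : 1ℤ + + n ≤ℤ + n
    excess = begin
      1ℤ + + n ≡⟨ cong (λ z → 1ℤ + z) n≡1+dw ⟩
      1ℤ + (1ℤ + d w) ≡⟨ +-assoc 1ℤ 1ℤ (d w) ⟨
      1ℤ + 1ℤ + d w ≡⟨ cong₂ _+_ (cong₂ _+_ (∑-δ w (λ _ → 1ℤ)) (∑-δ i (λ _ → 1ℤ))) (sym (pos-deg G w)) ⟨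
      ∑ f + ∑ g + ∑ α ≡⟨ cong (λ z → z + ∑ α) (∑-+ f g) ⟨
      ∑ (λ b → f b + g b) + ∑ α ≡⟨ ∑-+ (λ b → f b + g b) α ⟨
      ∑ (λ b → f b + g b + α b) ≤⟨ ∑-mono-≤ upper ⟩
      ∑ {n} (λ _ → 1ℤ) ≡⟨ ∑-one n ⟩
      + n ∎
      where open ≤-Reasoning

  π : Fin n → ℤ
  π i = ⟦ does (deg G i ℕ.≟ 1) ⟧

  π≡1 : ∀ {i} → deg G i ≡ 1 → π i ≡ 1ℤ
  π≡1 {i} deg≡1 = cong ⟦_⟧ (Dec.dec-true (deg G i ℕ.≟ 1) deg≡1)

  π≡0 : ∀ {i} → deg G i ≢ 1 → π i ≡ 0ℤ
  π≡0 {i} deg≢1 = cong ⟦_⟧ (Dec.dec-false (deg G i ℕ.≟ 1) deg≢1)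

  -- The three summands have disjoint supports: a vertex i of degree one other than w has x(i) +
  -- α(i) = 1, so if it has an edge in G - w it is not adjacent to w, while x(w) = 0.
  pendants-off-w : ∑ (λ i → π i * x i) + (1ℤ + d w) ≤ℤ + n
  pendants-off-w = begin
    ∑ f + (1ℤ + d w) ≡⟨ cong (λ z → ∑ f + z) (cong₂ _+_ (∑-δ w (λ _ → 1ℤ)) (sym (pos-deg G w))) ⟨
    ∑ f + (∑ g + ∑ α) ≡⟨ cong (λ z → ∑ f + z) (∑-+ g α) ⟨
    ∑ f + ∑ (λ i → g i + α i) ≡⟨ ∑-+ f (λ i → g i + α i) ⟨
    ∑ (λ i → f i + (g i + α i)) ≤⟨ ∑-mono-≤ upper ⟩
    ∑ {n} (λ _ → 1ℤ) ≡⟨ ∑-one n ⟩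
    + n ∎
    where
    open ≤-Reasoning
    f = λ i → π i * x i
    g = λ i → δ w i * 1ℤ
    upper : ∀ i → f i + (g i + α i) ≤ℤ 1ℤ
    upper i = cases (w ≟ i) (deg G i ℕ.≟ 1)
      where
      cancel : ∀ p y a → p * y + (0ℤ * 1ℤ + a) ≡ p * y + a
      cancel = solve-∀
      cases : Dec (w ≡ i) → Dec (deg G i ≡ 1) → f i + (g i + α i) ≤ℤ 1ℤ
      cases (yes refl) _ = ≤-reflexive
        (cong₂ _+_ (trans (cong (λ y → π w * y) xw≡0) (*-zeroʳ (π w)))
          (cong₂ (λ y b → y * 1ℤ + ⟦ b ⟧) (δ-refl w) (irrefl G w)))
      cases (no w≢i) deg≟1 = subst (_≤ℤ 1ℤ)
        (sym (trans (cong (λ y → f i + (y * 1ℤ + α i)) (δ-≢ w≢i)) (cancel (π i) (x i) (α i))))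
        (at-most-one deg≟1)
        where
        at-most-one : Dec (deg G i ≡ 1) → π i * x i + α i ≤ℤ 1ℤ
        at-most-one (yes deg≡1) = ≤-reflexive
          (trans (cong (λ y → y + α i) (trans (cong (λ p → p * x i) (π≡1 deg≡1)) (*-identityˡ (x i))))
            (trans (sym (d≡x+α w≢i)) (cong +_ deg≡1)))
        at-most-one (no deg≢1) = subst (_≤ℤ 1ℤ)
          (sym (trans (cong (λ p → p * x i + α i) (π≡0 deg≢1)) (+-identityˡ (α i)))) (⟦⟧≤1 (adj G w i))

  module _ (D : ℤ) (dw : d w ≡ D + 1ℤ) where

    -- The bound on a weight is linear in the number of pendent ends, so that it can be summed by
    -- `∑∑-off-*`. An edge with two such ends is charged more than `P`, which is harmless as M ≤ P;
    -- the same inequality allows the count of pendent ends to be raised to t.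
    sigma≤estimate : ∀ t k P M → ∑ x ≡ + 2 * (k + t) → + n ≡ D + + 2 + t → M ≤ℤ P →
      (∀ {i j} → OffEdge i j → wt D i j ≤ℤ M + (P - M) * (π i + π j)) →
      + sigma G ≤ℤ estimate D t k P M
    sigma≤estimate t k P M ∑x≡ n≡ M≤P wt≤ = *-cancelˡ-≤-pos _ _ (+ 2) (begin
      + 2 * + sigma G
        ≡⟨ sigma-expansion D dw ⟩
      E + ∑∑ (λ i j → ⟦ off i j ⟧ * wt D i j)
        ≤⟨ +-monoʳ-≤ E (∑∑-mono-≤ edgewise) ⟩
      E + ∑∑ (λ i j → M * ⟦ off i j ⟧ + (P - M) * (⟦ off i j ⟧ * (π i + π j)))
        ≡⟨ cong (λ z → E + z) (∑∑-+ (λ i j → M * ⟦ off i j ⟧) (λ i j → (P - M) * (⟦ off i j ⟧ * (π i + π j)))) ⟩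
      E + (∑∑ (λ i j → M * ⟦ off i j ⟧) + ∑∑ (λ i j → (P - M) * (⟦ off i j ⟧ * (π i + π j))))
        ≡⟨ cong₂ (λ y z → E + (y + z)) (∑∑-*ˡ M (λ i j → ⟦ off i j ⟧))
             (trans (∑∑-*ˡ (P - M) (λ i j → ⟦ off i j ⟧ * (π i + π j))) (cong (λ z → (P - M) * z) (∑∑-off-* π))) ⟩
      E + (M * ∑ x + (P - M) * (+ 2 * pend))
        ≡⟨ cong (λ z → E + (M * z + (P - M) * (+ 2 * pend))) ∑x≡ ⟩
      E + (M * (+ 2 * (k + t)) + (P - M) * (+ 2 * pend))
        ≤⟨ ≤-via refl ((slack M≤P) ⊗ (lit 2 ⊗ slack pend≤t)) (collect D t k P M pend) ⟩
      + 2 * ((D + 1ℤ) * (D * D) + t * P + k * M)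
        ≡⟨ cong (λ z → + 2 * z) (estimate-def D t k P M) ⟨
      + 2 * estimate D t k P M ∎)
      where
      open ≤-Reasoning
      E = + 2 * ((D + 1ℤ) * (D * D))
      pend = ∑ (λ i → π i * x i)
      pend≤t : pend ≤ℤ t
      pend≤t = ≤-via refl
        (slack (subst₂ (λ y z → pend + (1ℤ + y) ≤ℤ z) dw n≡ pendants-off-w)) (shift D t pend)
        where
        shift : ∀ D t p → t - p ≡ D + + 2 + t - (p + (1ℤ + (D + 1ℤ)))
        shift = solve-∀
      collect : ∀ D t k P M p → + 2 * ((D + 1ℤ) * (D * D) + t * P + k * M)
          - (+ 2 * ((D + 1ℤ) * (D * D)) + (M * (+ 2 * (k + t)) + (P - M) * (+ 2 * p))) ≡
        (P - M) * (+ 2 * (t - p))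
      collect = solve-∀
      edgewise : ∀ i j → ⟦ off i j ⟧ * wt D i j ≤ℤ M * ⟦ off i j ⟧ + (P - M) * (⟦ off i j ⟧ * (π i + π j))
      edgewise i j with off-view i j
      ... | inj₁ eq rewrite eq = ≤-reflexive (zeros (wt D i j) M (P - M) (π i + π j))
        where
        zeros : ∀ v M R p → 0ℤ * v ≡ M * 0ℤ + R * (0ℤ * p)
        zeros = solve-∀
      ... | inj₂ (eq , e) rewrite eq = subst₂ _≤ℤ_ (sym (*-identityˡ (wt D i j))) (ones M (P - M) (π i + π j)) (wt≤ e)
        where
        ones : ∀ M R p → M + R * p ≡ M * 1ℤ + R * (1ℤ * p)
        ones = solve-∀

    sigma≡estimate : ∀ k P M → ∑ x ≡ + 2 * k → (∀ {i j} → OffEdge i j → wt D i j ≡ M) →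
      + sigma G ≡ estimate D 0ℤ k P M
    sigma≡estimate k P M ∑x≡ wt≡ = *-cancelˡ-≡ (+ 2) _ _ (begin
      + 2 * + sigma G
        ≡⟨ sigma-expansion D dw ⟩
      E + ∑∑ (λ i j → ⟦ off i j ⟧ * wt D i j)
        ≡⟨ cong (λ z → E + z) (trans (∑∑-cong edgewise) (∑∑-*ˡ M (λ i j → ⟦ off i j ⟧))) ⟩
      E + M * ∑ x
        ≡⟨ cong (λ z → E + M * z) ∑x≡ ⟩
      E + M * (+ 2 * k)
        ≡⟨ collect D k P M ⟩
      + 2 * ((D + 1ℤ) * (D * D) + 0ℤ * P + k * M)
        ≡⟨ cong (λ z → + 2 * z) (estimate-def D 0ℤ k P M) ⟨
      + 2 * estimate D 0ℤ k P M ∎)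
      where
      open ≡-Reasoning
      E = + 2 * ((D + 1ℤ) * (D * D))
      collect : ∀ D k P M → + 2 * ((D + 1ℤ) * (D * D)) + M * (+ 2 * k) ≡
        + 2 * ((D + 1ℤ) * (D * D) + 0ℤ * P + k * M)
      collect = solve-∀
      edgewise : ∀ i j → ⟦ off i j ⟧ * wt D i j ≡ M * ⟦ off i j ⟧
      edgewise i j with off-view i j
      ... | inj₁ eq rewrite eq = sym (*-zeroʳ M)
      ... | inj₂ (eq , e) rewrite eq = trans (cong (λ z → 1ℤ * z) (wt≡ e)) (*-comm 1ℤ M)

-- The shape of H_{n,k}: w is the centre and u the fixed pendent vertex.
record DoubleStar {n : ℕ} (G : Graph n) (w u : Fin n) : Set where
  field
    w≢u      : w ≢ u
    centre   : ∀ {i} → w ≢ i → adj G w i ≡ true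
    touching : Off.Touching G w u

-- The bound for k-cyclic graphs, relative to a vertex w

module Size {n : ℕ} (k : ℕ) (G : Graph n) (size≡ : size G ℕ.+ 1 ≡ n ℕ.+ k) where

  K : ℤ
  K = + k

  +size : + size G ≡ + n + K - 1ℤ
  +size = begin
    + size G               ≡⟨ cancel (+ size G) ⟩
    + size G + 1ℤ - 1ℤ     ≡⟨ cong (λ z → z - 1ℤ) (trans (cong +_ size≡) (pos-+ n k)) ⟩
    + n + K - 1ℤ           ∎
    where
    open ≡-Reasoning
    cancel : ∀ z → z ≡ z + 1ℤ - 1ℤ
    cancel = solve-∀

  module _ (w : Fin n) where
    open Off G w

    D t : ℤ
    D = d w - 1ℤ
    t = + n - 1ℤ - d w

    dw≡D+1 : d w ≡ D + 1ℤ
    dw≡D+1 = cancel (d w)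
      where
      cancel : ∀ z → z ≡ z - 1ℤ + 1ℤ
      cancel = solve-∀

    n≡D+2+t : + n ≡ D + + 2 + t
    n≡D+2+t = cancel (+ n) (d w)
      where
      cancel : ∀ N z → N ≡ z - 1ℤ + + 2 + (N - 1ℤ - z)
      cancel = solve-∀

    ∑x≡2[K+t] : ∑ x ≡ + 2 * (K + t)
    ∑x≡2[K+t] = trans ∑x (trans (cong (λ z → + 2 * z - + 2 * d w) +size) (regroup (+ n) K (d w)))
      where
      regroup : ∀ N K z → + 2 * (N + K - 1ℤ) - + 2 * z ≡ + 2 * (K + (N - 1ℤ - z))
      regroup = solve-∀

    0≤t : 0ℤ ≤ℤ t
    0≤t = ≤-via refl (slack pendants-off-w ⊕ ∑-nonneg (λ i → 0≤⟦ does (deg G i ℕ.≟ 1) ⟧ ⊗ x-nonneg i))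
      (cancel (+ n) (d w) (∑ (λ i → π i * x i)))
      where
      cancel : ∀ N z p → N - 1ℤ - z - 0ℤ ≡ N - (p + (1ℤ + z)) + p
      cancel = solve-∀

    x+x≤q+1 : ∀ {i j} → OffEdge i j → x i + x j ≤ℤ K + t + 1ℤ
    x+x≤q+1 {i} {j} e = ≤-via refl
      (slack (*-cancelˡ-≤-pos (x i + x j - 1ℤ) (K + t) (+ 2) (subst (+ 2 * (x i + x j - 1ℤ) ≤ℤ_) ∑x≡2[K+t] (x+x≤ e))))
      (shift (x i + x j) (K + t))
      where
      shift : ∀ s q → q + 1ℤ - s ≡ q - (s - 1ℤ)
      shift = solve-∀

    module _ (t≡0 : t ≡ 0ℤ) where

      n≡1+dw : + n ≡ 1ℤ + d w
      n≡1+dw = begin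
        + n              ≡⟨ cancel (+ n) (d w) ⟩
        1ℤ + d w + t     ≡⟨ cong (λ z → 1ℤ + d w + z) t≡0 ⟩
        1ℤ + d w + 0ℤ    ≡⟨ +-identityʳ (1ℤ + d w) ⟩
        1ℤ + d w         ∎
        where
        open ≡-Reasoning
        cancel : ∀ N z → N ≡ 1ℤ + z + (N - 1ℤ - z)
        cancel = solve-∀

      centre : ∀ {i} → w ≢ i → adj G w i ≡ true
      centre = dominating n≡1+dw

      ∑x≡2K : ∑ x ≡ + 2 * K
      ∑x≡2K = trans ∑x≡2[K+t] (cong (λ z → + 2 * z) (trans (cong (λ z → K + z) t≡0) (+-identityʳ K)))

      x+x≤K+1 : ∀ {i j} → OffEdge i j → x i + x j ≤ℤ K + 1ℤ
      x+x≤K+1 {i} {j} e = subst (λ z → x i + x j ≤ℤ z + 1ℤ) (trans (cong (λ z → K + z) t≡0) (+-identityʳ K)) (x+x≤q+1 e)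

      wt≡weight₁₁ : ∀ {i j} → OffEdge i j → wt D i j ≡ weight D 1ℤ 1ℤ (x i) (x j)
      wt≡weight₁₁ {i} {j} (offEdge w≢i w≢j _) =
        cong₂ (λ a b → weight D ⟦ a ⟧ ⟦ b ⟧ (x i) (x j)) (centre w≢i) (centre w≢j)

      -- The weight of an edge with {x(i), x(j)} = {K, 1}, by `weight₁₁-extremal`.
      X : ℤ
      X = K * K - K + + 2 - + 4 * D

      bound≡estimate : ∀ P → sigmaBound (+ n) K ≡ estimate D 0ℤ K P X
      bound≡estimate P = trans
        (cong (λ N → sigmaBound N K) (trans n≡D+2+t (trans (cong (λ z → D + + 2 + z) t≡0) (+-identityʳ (D + + 2)))))
        (bound-dominating D K P)

      sigma≤uniform : ∀ M → (∀ {i j} → OffEdge i j → weight D 1ℤ 1ℤ (x i) (x j) ≤ℤ M) →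
        + sigma G ≤ℤ estimate D 0ℤ K M M
      sigma≤uniform M w≤M = sigma≤estimate D dw≡D+1 0ℤ K M M
        (trans ∑x≡2K (cong (λ z → + 2 * z) (sym (+-identityʳ K))))
        (trans n≡D+2+t (cong (λ z → D + + 2 + z) t≡0)) ≤-refl
        (λ {i} {j} e → subst₂ _≤ℤ_ (sym (wt≡weight₁₁ e)) (pad M (π i + π j)) (w≤M e))
        where
        pad : ∀ M p → M ≡ M + (M - M) * p
        pad = solve-∀

      sigma≤bound : + sigma G ≤ℤ sigmaBound (+ n) K
      sigma≤bound = subst (+ sigma G ≤ℤ_) (sym (bound≡estimate X))
        (sigma≤uniform X (λ e → weight₁₁≤ D K _ _ (1≤x e) (1≤x (OffEdge-sym e)) (x+x≤K+1 e)))

      -- Every one of the K edges of G - w falls short of `X` by at least 1, and there is such an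
      -- edge because 1 ≤ K.
      sigma<bound : 1ℤ ≤ℤ K → (∀ u → w ≢ u → x u ≢ K) → 1ℤ + + sigma G ≤ℤ sigmaBound (+ n) K
      sigma<bound 1≤K x≢K = begin
        1ℤ + + sigma G
          ≤⟨ +-monoʳ-≤ 1ℤ (sigma≤uniform (X - 1ℤ) edgewise) ⟩
        1ℤ + estimate D 0ℤ K (X - 1ℤ) (X - 1ℤ)
          ≤⟨ ≤-via (cong (λ z → 1ℤ + z) (estimate-def D 0ℤ K (X - 1ℤ) (X - 1ℤ))) (slack 1≤K) (gap D K X) ⟩
        (D + 1ℤ) * (D * D) + 0ℤ * (X - 1ℤ) + K * X
          ≡⟨ estimate-def D 0ℤ K (X - 1ℤ) X ⟨
        estimate D 0ℤ K (X - 1ℤ) X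
          ≡⟨ bound≡estimate (X - 1ℤ) ⟨
        sigmaBound (+ n) K ∎
        where
        open ≤-Reasoning
        gap : ∀ D K X → (D + 1ℤ) * (D * D) + 0ℤ * (X - 1ℤ) + K * X
            - (1ℤ + ((D + 1ℤ) * (D * D) + 0ℤ * (X - 1ℤ) + K * (X - 1ℤ))) ≡ K - 1ℤ
        gap = solve-∀
        x<K : ∀ {i j} → OffEdge i j → x i + 1ℤ ≤ℤ K
        x<K {i} {j} e@(offEdge w≢i _ _) = subst (_≤ℤ K) (+-comm 1ℤ (x i))
          (i<j⇒suc[i]≤j (≤∧≢⇒<
            (≤-via refl (slack (x+x≤K+1 e) ⊕ slack (1≤x (OffEdge-sym e))) (drop (x i) (x j) K))
            (x≢K i w≢i)))
          where
          drop : ∀ a b K → K - a ≡ K + 1ℤ - (a + b) + (b - 1ℤ)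
          drop = solve-∀
        edgewise : ∀ {i j} → OffEdge i j → weight D 1ℤ 1ℤ (x i) (x j) ≤ℤ X - 1ℤ
        edgewise e = weight₁₁< D K _ _ (1≤x e) (1≤x (OffEdge-sym e)) (x+x≤K+1 e) (x<K e) (x<K (OffEdge-sym e))

      sigma≡bound : ∀ u → Touching u → + sigma G ≡ sigmaBound (+ n) K
      sigma≡bound u touching = trans (sigma≡estimate D dw≡D+1 K X X ∑x≡2K extremal) (sym (bound≡estimate X))
        where
        xu≡K : x u ≡ K
        xu≡K = *-cancelˡ-≡ (+ 2) (x u) K (trans (sym (touching⇒full-degree u touching)) ∑x≡2K)
        other≡1 : ∀ {i} → OffEdge u i → x i ≡ 1ℤ
        other≡1 {i} e = ≤-antisym
          (≤-via refl (slack (subst (λ z → z + x i ≤ℤ K + 1ℤ) xu≡K (x+x≤K+1 e))) (drop K (x i))) (1≤x (OffEdge-sym e))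
          where
          drop : ∀ K a → 1ℤ - a ≡ K + 1ℤ - (K + a)
          drop = solve-∀
        extremal : ∀ {i j} → OffEdge i j → wt D i j ≡ X
        extremal {i} {j} e with touching e
        ... | inj₁ refl = trans (wt≡weight₁₁ e)
                (trans (cong₂ (weight D 1ℤ 1ℤ) xu≡K (other≡1 e)) (weight₁₁-extremal D K))
        ... | inj₂ refl = trans (wt≡weight₁₁ e) (trans (weight-sym D 1ℤ 1ℤ (x i) (x j))
                (trans (cong₂ (weight D 1ℤ 1ℤ) xu≡K (other≡1 (OffEdge-sym e))) (weight₁₁-extremal D K)))

    module _ (4≤n : + 4 ≤ℤ + n) (K≤n-2 : K ≤ℤ + n - + 2) (max : ∀ i → d i ≤ℤ d w) where

      -- If all degrees were at most one, the degree sum would give 2(n + k - 1) ≤ n, impossible for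
      -- n ≥ 4.
      1≤D : 1ℤ ≤ℤ D
      1≤D with + 2 ℤ.≤? d w
      ... | yes 2≤dw = ≤-via refl (slack 2≤dw) (shift (d w))
        where
        shift : ∀ z → z - 1ℤ - 1ℤ ≡ z - + 2
        shift = solve-∀
      ... | no 2≰dw = contradiction
        (≤-via refl (slack few ⊕ slack 4≤n ⊕ lit 2 ⊗ lit k ⊕ lit 1) (excess (+ n) K)) (1+i≰i (+ n))
        where
        few : + 2 * (+ n + K - 1ℤ) ≤ℤ + n
        few = begin
          + 2 * (+ n + K - 1ℤ) ≡⟨ cong (λ z → + 2 * z) +size ⟨
          + 2 * + size G ≡⟨ handshake G (λ _ _ → 1) (λ _ _ → refl) ⟩
          ∑∑ (λ i j → ⟦ adj G i j ⟧ * 1ℤ) ≡⟨ ∑∑-cong (λ i j → *-identityʳ ⟦ adj G i j ⟧) ⟩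
          ∑∑ (λ i j → ⟦ adj G i j ⟧) ≡⟨ ∑-cong (pos-deg G) ⟨
          ∑ d ≤⟨ ∑-mono-≤ (λ i → ≤-trans (max i) (≤-via refl (slack (i<j⇒suc[i]≤j (≰⇒> 2≰dw))) (shift (d w)))) ⟩
          ∑ {n} (λ _ → 1ℤ) ≡⟨ ∑-one n ⟩
          + n ∎
          where
          open ≤-Reasoning
          shift : ∀ z → 1ℤ - z ≡ + 2 - (1ℤ + z)
          shift = solve-∀
        excess : ∀ N K → N - (1ℤ + N) ≡ N - + 2 * (N + K - 1ℤ) + (N - + 4 + (+ 2 * K + + 1))
        excess = solve-∀

      0≤D : 0ℤ ≤ℤ D
      0≤D = ≤-trans (lit 1) 1≤D

      d≤D+1 : ∀ {i} → w ≢ i → x i + α i ≤ℤ D + 1ℤ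
      d≤D+1 {i} w≢i = subst₂ _≤ℤ_ (d≡x+α w≢i) dw≡D+1 (max i)

      1≤d : ∀ {i j} → OffEdge i j → 1ℤ ≤ℤ x i + α i
      1≤d {i} e = ≤-trans (1≤x e) (i≤i+⟦ adj G w i ⟧)
        where
        i≤i+⟦_⟧ : ∀ {i} b → i ≤ℤ i + ⟦ b ⟧
        i≤i+⟦_⟧ {i} b = ≤-via refl (0≤⟦ b ⟧) (cancel i ⟦ b ⟧)
          where
          cancel : ∀ i b → i + b - i ≡ b
          cancel = solve-∀

      2≤d : ∀ {i j} → OffEdge i j → deg G i ≢ 1 → + 2 ≤ℤ x i + α i
      2≤d {i} e@(offEdge w≢i _ _) deg≢1 = i<j⇒suc[i]≤j
        (≤∧≢⇒< (1≤d e) (λ 1≡d → deg≢1 (+-injective (trans (d≡x+α w≢i) (sym 1≡d)))))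

      sigma≤P,M : ∀ P M → M ≤ℤ P → (∀ {i j} → OffEdge i j → wt D i j ≤ℤ P) →
        (∀ {i j} → OffEdge i j → + 2 ≤ℤ x i + α i → + 2 ≤ℤ x j + α j → wt D i j ≤ℤ M) →
        + sigma G ≤ℤ estimate D t K P M
      sigma≤P,M P M M≤P wt≤P wt≤M = sigma≤estimate D dw≡D+1 t K P M ∑x≡2[K+t] n≡D+2+t M≤P
        (λ {i} {j} e → edgewise e (deg G i ℕ.≟ 1) (deg G j ℕ.≟ 1))
        where
        edgewise : ∀ {i j} → OffEdge i j → Dec (deg G i ≡ 1) → Dec (deg G j ≡ 1) →
          wt D i j ≤ℤ M + (P - M) * (π i + π j)
        edgewise {i} {j} e (yes deg≡1) _ = ≤-trans (wt≤P e)
          (subst (λ z → P ≤ℤ M + (P - M) * (z + π j)) (sym (π≡1 deg≡1))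
            (≤-via refl (slack M≤P ⊗ 0≤⟦ does (deg G j ℕ.≟ 1) ⟧) (expand P M (π j))))
          where
          expand : ∀ P M p → M + (P - M) * (1ℤ + p) - P ≡ (P - M) * p
          expand = solve-∀
        edgewise {i} {j} e (no _) (yes deg≡1) = ≤-trans (wt≤P e)
          (subst (λ z → P ≤ℤ M + (P - M) * (π i + z)) (sym (π≡1 deg≡1))
            (≤-via refl (slack M≤P ⊗ 0≤⟦ does (deg G i ℕ.≟ 1) ⟧) (expand P M (π i))))
          where
          expand : ∀ P M p → M + (P - M) * (p + 1ℤ) - P ≡ (P - M) * p
          expand = solve-∀
        edgewise {i} {j} e (no i≢1) (no j≢1) = ≤-trans (wt≤M e (2≤d e i≢1) (2≤d (OffEdge-sym e) j≢1))
          (≤-via refl (slack M≤P ⊗ (0≤⟦ does (deg G i ℕ.≟ 1) ⟧ ⊕ 0≤⟦ does (deg G j ℕ.≟ 1) ⟧))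
            (expand P M (π i + π j)))
          where
          expand : ∀ P M p → M + (P - M) * p - M ≡ (P - M) * p
          expand = solve-∀

      private
        q : ℤ
        q = K + t

        wt≤spread : ∀ {i j} → OffEdge i j → wt D i j ≤ℤ D * D
        wt≤spread {i} {j} e@(offEdge w≢i w≢j _) = subst (wt D i j ≤ℤ_) (square D)
          (weight≤-spread 1ℤ (adj G w i) (adj G w j) 0≤D (1≤d e) (1≤d (OffEdge-sym e)) (d≤D+1 w≢i) (d≤D+1 w≢j))
          where
          square : ∀ D → (D + 1ℤ - 1ℤ) * (D + 1ℤ - 1ℤ) ≡ D * D
          square = solve-∀

        finish : ∀ {E} → + sigma G ≤ℤ E → 1ℤ + E ≤ℤ sigmaBound (D + + 2 + t) K →
          1ℤ + + sigma G ≤ℤ sigmaBound (+ n) K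
        finish σ≤E 1+E≤bound = subst (λ N → 1ℤ + + sigma G ≤ℤ sigmaBound N K) (sym n≡D+2+t)
          (≤-trans (+-monoʳ-≤ 1ℤ σ≤E) 1+E≤bound)

      low : 1ℤ ≤ℤ t → q ≤ℤ D → 1ℤ + + sigma G ≤ℤ sigmaBound (+ n) K
      low 1≤t q≤D = finish
        (sigma≤P,M (q * q - q + + 3) (q * q - + 5 * q + + 7)
          (≤-via refl (lit 4 ⊗ (slack 1≤t ⊕ lit k)) (gap K t))
          (λ {i} {j} e → weight≤-low (adj G w i) (adj G w j) 0≤D (1≤x e) (1≤x (OffEdge-sym e)) (x+x≤q+1 e) q≤D)
          (λ {i} {j} e 2≤di 2≤dj → weight≤-nonpendant (adj G w i) (adj G w j)
            (1≤x e) (1≤x (OffEdge-sym e)) (x+x≤q+1 e) 2≤di 2≤dj (≤-via refl (slack q≤D ⊕ lit 1) (shift D q))))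
        (bound-gap-low D t K (lit k) (slack 1≤t) (slack q≤D))
        where
        gap : ∀ K t → let q = K + t in q * q - q + + 3 - (q * q - + 5 * q + + 7) ≡ + 4 * (t - 1ℤ + K)
        gap = solve-∀
        shift : ∀ D q → D + 1ℤ - q ≡ D - q + 1ℤ
        shift = solve-∀

      -- The two sources of bounds are mixed: `P` comes from the range of degrees, `M` from x(i) +
      -- x(j) ≤ q + 1. The value (D - 1)² used for `M` in `high` would exceed the present one by q -
      -- 3 on each of k edges, too much for the margin of 2 at t = 1 when k is large.
      middle : 1ℤ ≤ℤ t → q ≡ D + 1ℤ → 1ℤ + + sigma G ≤ℤ sigmaBound (+ n) K
      middle 1≤t q≡D+1 = finish
        (sigma≤P,M (D * D) (q * q - + 5 * q + + 7)
          (subst (λ q → q * q - + 5 * q + + 7 ≤ℤ D * D) (sym q≡D+1) (≤-via refl (lit 3 ⊗ slack 1≤D) (gap D)))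
          wt≤spread
          (λ {i} {j} e 2≤di 2≤dj → weight≤-nonpendant (adj G w i) (adj G w j)
            (1≤x e) (1≤x (OffEdge-sym e)) (x+x≤q+1 e) 2≤di 2≤dj (≤-reflexive q≡D+1)))
        (subst (λ D → 1ℤ + estimate D t K (D * D) (q * q - + 5 * q + + 7) ≤ℤ sigmaBound (D + + 2 + t) K)
          (trans (cong (λ z → z - 1ℤ) q≡D+1) (cancel D)) (bound-gap-middle t K (lit k) (slack 1≤t)))
        where
        gap : ∀ D → let q = D + 1ℤ in D * D - (q * q - + 5 * q + + 7) ≡ + 3 * (D - 1ℤ)
        gap = solve-∀
        cancel : ∀ D → D + 1ℤ - 1ℤ ≡ D
        cancel = solve-∀

      high : D + + 2 ≤ℤ q → 1ℤ + + sigma G ≤ℤ sigmaBound (+ n) K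
      high D+2≤q = finish
        (sigma≤P,M (D * D) ((D - 1ℤ) * (D - 1ℤ))
          (≤-via refl (lit 2 ⊗ slack 1≤D ⊕ lit 1) (gap D))
          wt≤spread
          (λ {i} {j} e@(offEdge w≢i w≢j _) 2≤di 2≤dj → subst (wt D i j ≤ℤ_) (square D)
            (weight≤-spread (+ 2) (adj G w i) (adj G w j) 0≤D 2≤di 2≤dj (d≤D+1 w≢i) (d≤D+1 w≢j))))
        (bound-gap-high D t K (lit k) (slack 1≤D)
          (subst (0ℤ ≤ℤ_) (regroup K t D) (slack D+2≤q))
          (subst (0ℤ ≤ℤ_) (vertices (+ n) K (d w)) (slack K≤n-2))
          (subst (0ℤ ≤ℤ_) (vertices′ (+ n) (d w)) (slack 4≤n)))
        where
        gap : ∀ D → D * D - (D - 1ℤ) * (D - 1ℤ) ≡ + 2 * (D - 1ℤ) + 1ℤ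
        gap = solve-∀
        square : ∀ D → (D + 1ℤ - + 2) * (D + 1ℤ - + 2) ≡ (D - 1ℤ) * (D - 1ℤ)
        square = solve-∀
        regroup : ∀ K t D → K + t - (D + + 2) ≡ K + t - D - + 2
        regroup = solve-∀
        vertices : ∀ N K z → N - + 2 - K ≡ z - 1ℤ + (N - 1ℤ - z) - K
        vertices = solve-∀
        vertices′ : ∀ N z → N - + 4 ≡ z - 1ℤ + (N - 1ℤ - z) - + 2
        vertices′ = solve-∀

      nondominating : 1ℤ ≤ℤ t → 1ℤ + + sigma G ≤ℤ sigmaBound (+ n) K
      nondominating 1≤t with q ℤ.≤? D | q ℤ.≤? D + 1ℤ
      ... | yes q≤D | _ = low 1≤t q≤D
      ... | no q≰D | yes q≤D+1 = middle 1≤t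
        (≤-antisym q≤D+1 (subst (_≤ℤ q) (+-comm 1ℤ D) (i<j⇒suc[i]≤j (≰⇒> q≰D))))
      ... | no _ | no q≰D+1 = high (subst (_≤ℤ q) (shift D) (i<j⇒suc[i]≤j (≰⇒> q≰D+1)))
        where
        shift : ∀ D → 1ℤ + (D + 1ℤ) ≡ D + + 2
        shift = solve-∀

-- The extremal graphs

maximum : ∀ {n} (f : Fin (ℕ.suc n) → ℕ) → ∃ λ w → ∀ i → f i ≤ f w
maximum {ℕ.zero} f = zero , λ { zero → ℕ.≤-refl }
maximum {ℕ.suc n} f with maximum (f ∘ suc)
... | w , max with ℕ.≤-total (f zero) (f (suc w))
...   | inj₁ f0≤fw = suc w , λ { zero → f0≤fw ; (suc i) → max i }
...   | inj₂ fw≤f0 = zero , λ { zero → ℕ.≤-refl ; (suc i) → ℕ.≤-trans (max i) fw≤f0 }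

-- Vertex zero is matched with some j of its colour, which exists because that colour occurs on the
-- left. Removing both keeps the counts equal, so induction matches the rest.
matching-colours : ∀ {n m} (c c′ : Fin n → Fin m) →
  (∀ a → ∑ (λ i → δ a (c i)) ≡ ∑ (λ i → δ a (c′ i))) →
  ∃ λ (ρ : Permutation n n) → ∀ i → c i ≡ c′ (ρ ⟨$⟩ʳ i)
matching-colours {ℕ.zero} c c′ counts = Perm.id , λ ()
matching-colours {ℕ.suc n} c c′ counts with any? (λ j → c zero ≟ c′ j)
... | no c0≢ = contradiction
  (subst₂ _≤ℤ_ (δ-refl (c zero)) 
    (trans (counts (c zero)) (trans (∑-cong (λ j → δ-≢ (λ eq → c0≢ (j , eq)))) (∑-zero (ℕ.suc n))))
    (term≤∑ (λ i → 0≤⟦ does (c zero ≟ c i) ⟧) zero))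
  λ { (+≤+ ()) }
... | yes (j , c0≡c′j) = Perm.insert zero j (proj₁ rest) , matches
  where
  counts-rest : ∀ a → ∑ (λ i → δ a (c (suc i))) ≡ ∑ (λ i → δ a (c′ (punchIn j i)))
  counts-rest a = begin
    ∑ (λ i → δ a (c (suc i))) ≡⟨ cancel (δ a (c zero)) _ ⟩
    δ a (c zero) + ∑ (λ i → δ a (c (suc i))) - δ a (c zero)
      ≡⟨ cong (λ z → z - δ a (c zero)) (∑-punchIn (λ i → δ a (c i)) zero) ⟨
    ∑ (λ i → δ a (c i)) - δ a (c zero) ≡⟨ cong₂ (λ y z → y - δ a z) (counts a) c0≡c′j ⟩
    ∑ (λ i → δ a (c′ i)) - δ a (c′ j) ≡⟨ cong (λ z → z - δ a (c′ j)) (∑-punchIn (λ i → δ a (c′ i)) j) ⟩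
    δ a (c′ j) + ∑ (λ i → δ a (c′ (punchIn j i))) - δ a (c′ j) ≡⟨ cancel (δ a (c′ j)) _ ⟨
    ∑ (λ i → δ a (c′ (punchIn j i))) ∎
    where
    open ≡-Reasoning
    cancel : ∀ a s → s ≡ a + s - a
    cancel = solve-∀
  rest = matching-colours (c ∘ suc) (c′ ∘ punchIn j) counts-rest
  matches : ∀ i → c i ≡ c′ (Perm.insert zero j (proj₁ rest) ⟨$⟩ʳ i)
  matches zero = c0≡c′j
  matches (suc i) = trans (proj₂ rest i) (cong c′ (sym (Perm.insert-punchIn zero j (proj₁ rest) i)))

-- Sizes of the four classes of a double star: the centre, u, the other neighbours of u, and the
-- rest. The centre is itself a neighbour of u, hence d - 1.
count : ℤ → ℤ → Fin 4 → ℤ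
count N d 0F = 1ℤ
count N d 1F = 1ℤ
count N d 2F = d - 1ℤ
count N d 3F = N - 1ℤ - d

module Colouring {n : ℕ} {G : Graph n} {w u : Fin n} (S : DoubleStar G w u) where
  open DoubleStar S

  colour : Fin n → Fin 4
  colour i = if does (w ≟ i) then 0F else if does (u ≟ i) then 1F else if adj G u i then 2F else 3F

  count-colour : ∀ a → ∑ (λ i → δ a (colour i)) ≡ count (+ n) (+ deg G u) a
  count-colour 0F = trans (∑-cong indicator) (∑-δ w (λ _ → 1ℤ))
    where
    indicator : ∀ i → δ 0F (colour i) ≡ δ w i * 1ℤ
    indicator i with does (w ≟ i) | does (u ≟ i) | adj G u i
    ... | true  | _     | _     = refl
    ... | false | true  | _     = refl
    ... | false | false | true  = refl
    ... | false | false | false = refl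
  count-colour 1F = trans (∑-cong indicator) (∑-δ u (λ _ → 1ℤ))
    where
    indicator : ∀ i → δ 1F (colour i) ≡ δ u i * 1ℤ
    indicator i with w ≟ i | u ≟ i | adj G u i
    ... | yes refl | yes refl | _ = contradiction refl w≢u
    ... | yes _ | no _  | _     = refl
    ... | no _  | yes _ | _     = refl
    ... | no _  | no _  | true  = refl
    ... | no _  | no _  | false = refl
  count-colour 2F = begin
    ∑ f ≡⟨ cancel (∑ f) ⟩
    ∑ f + 1ℤ - 1ℤ ≡⟨ cong (λ z → ∑ f + z - 1ℤ) (∑-δ w (λ _ → 1ℤ)) ⟨
    ∑ f + ∑ (λ i → δ w i * 1ℤ) - 1ℤ ≡⟨ cong (λ z → z - 1ℤ) (∑-+ f (λ i → δ w i * 1ℤ)) ⟨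
    ∑ (λ i → f i + δ w i * 1ℤ) - 1ℤ ≡⟨ cong (λ z → z - 1ℤ) (trans (∑-cong neighbour) (sym (pos-deg G u))) ⟩
    + deg G u - 1ℤ ∎
    where
    open ≡-Reasoning
    f = λ i → δ 2F (colour i)
    cancel : ∀ z → z ≡ z + 1ℤ - 1ℤ
    cancel = solve-∀
    neighbour : ∀ i → f i + δ w i * 1ℤ ≡ ⟦ adj G u i ⟧
    neighbour i with w ≟ i | u ≟ i | adj G u i in eq
    ... | yes refl | _ | true = refl
    ... | yes refl | _ | false with trans (sym eq) (trans (adj-sym G u w) (centre w≢u))
    ...   | ()
    neighbour i | no _ | yes refl | false = refl
    neighbour i | no _ | yes refl | true with trans (sym eq) (irrefl G u)
    ...   | ()
    neighbour i | no _ | no _ | true = refl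
    neighbour i | no _ | no _ | false = refl
  count-colour 3F = begin
    ∑ (f 3F) ≡⟨ cancel (∑ (f 0F)) (∑ (f 1F)) (∑ (f 2F)) (∑ (f 3F)) ⟩
    ∑ (f 0F) + ∑ (f 1F) + (∑ (f 2F) + ∑ (f 3F)) - ∑ (f 0F) - ∑ (f 1F) - ∑ (f 2F)
      ≡⟨ cong (λ z → z - ∑ (f 0F) - ∑ (f 1F) - ∑ (f 2F)) total ⟩
    + n - ∑ (f 0F) - ∑ (f 1F) - ∑ (f 2F)
      ≡⟨ cong₂ (λ y z → + n - y - z - ∑ (f 2F)) (count-colour 0F) (count-colour 1F) ⟩
    + n - 1ℤ - 1ℤ - ∑ (f 2F) ≡⟨ cong (λ z → + n - 1ℤ - 1ℤ - z) (count-colour 2F) ⟩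
    + n - 1ℤ - 1ℤ - (+ deg G u - 1ℤ) ≡⟨ collect (+ n) (+ deg G u) ⟩
    + n - 1ℤ - + deg G u ∎
    where
    open ≡-Reasoning
    f : Fin 4 → Fin n → ℤ
    f a i = δ a (colour i)
    cancel : ∀ a b c d → d ≡ a + b + (c + d) - a - b - c
    cancel = solve-∀
    collect : ∀ N d → N - 1ℤ - 1ℤ - (d - 1ℤ) ≡ N - 1ℤ - d
    collect = solve-∀
    one : ∀ i → f 0F i + f 1F i + (f 2F i + f 3F i) ≡ 1ℤ
    one i with colour i
    ... | 0F = refl
    ... | 1F = refl
    ... | 2F = refl
    ... | 3F = refl
    total : ∑ (f 0F) + ∑ (f 1F) + (∑ (f 2F) + ∑ (f 3F)) ≡ + n
    total = begin
      ∑ (f 0F) + ∑ (f 1F) + (∑ (f 2F) + ∑ (f 3F)) ≡⟨ cong₂ _+_ (∑-+ (f 0F) (f 1F)) (∑-+ (f 2F) (f 3F)) ⟨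
      ∑ (λ i → f 0F i + f 1F i) + ∑ (λ i → f 2F i + f 3F i) ≡⟨ ∑-+ (λ i → f 0F i + f 1F i) (λ i → f 2F i + f 3F i) ⟨
      ∑ (λ i → f 0F i + f 1F i + (f 2F i + f 3F i)) ≡⟨ ∑-cong one ⟩
      ∑ {n} (λ _ → 1ℤ) ≡⟨ ∑-one n ⟩
      + n ∎

pattern-adj : Fin 4 → Fin 4 → Bool
pattern-adj 0F 0F = false
pattern-adj 0F (suc _) = true
pattern-adj (suc _) 0F = true
pattern-adj 1F 2F = true
pattern-adj 2F 1F = true
pattern-adj (suc _) (suc _) = false

module _ {n : ℕ} {G : Graph n} {w u : Fin n} (S : DoubleStar G w u) where
  open DoubleStar S
  open Colouring S

  -- Edges at w and at u are recorded in the colours, and `touching` excludes any others. The class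
  -- sizes, hence n and the degree of u, then determine the graph up to isomorphism.
  adj-colour : ∀ i j → adj G i j ≡ pattern-adj (colour i) (colour j)
  adj-colour i j with w ≟ i | w ≟ j
  ... | yes refl | yes refl = irrefl G w
  ... | yes refl | no w≢j with does (u ≟ j) | adj G u j
  ...   | true  | _     = centre w≢j
  ...   | false | true  = centre w≢j
  ...   | false | false = centre w≢j
  adj-colour i j | no w≢i | yes refl with does (u ≟ i) | adj G u i
  ...   | true  | _     = trans (adj-sym G i w) (centre w≢i)
  ...   | false | true  = trans (adj-sym G i w) (centre w≢i)
  ...   | false | false = trans (adj-sym G i w) (centre w≢i)
  adj-colour i j | no w≢i | no w≢j with u ≟ i | u ≟ j
  ... | yes refl | yes refl = irrefl G u
  ... | yes refl | no _ with adj G u j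
  ...   | true  = refl
  ...   | false = refl
  adj-colour i j | no w≢i | no w≢j | no _ | yes refl with adj G u i in eq
  ...   | true  = trans (adj-sym G i u) eq
  ...   | false = trans (adj-sym G i u) eq
  adj-colour i j | no w≢i | no w≢j | no u≢i | no u≢j with adj G i j in eq
  ... | true with touching (Off.offEdge w≢i w≢j eq)
  ...   | inj₁ u≡i = contradiction u≡i u≢i
  ...   | inj₂ u≡j = contradiction u≡j u≢j
  adj-colour i j | no w≢i | no w≢j | no u≢i | no u≢j | false with adj G u i | adj G u j
  ...   | true  | true  = refl
  ...   | true  | false = refl
  ...   | false | true  = refl
  ...   | false | false = refl

doubleStar-≅ : ∀ {n} {G G′ : Graph n} {w u w′ u′} → DoubleStar G w u → DoubleStar G′ w′ u′ →
  deg G u ≡ deg G′ u′ → G ≅ G′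
doubleStar-≅ {n} S S′ deg≡ = proj₁ matching , λ i j → trans (adj-colour S i j)
  (trans (cong₂ pattern-adj (proj₂ matching i) (proj₂ matching j)) (sym (adj-colour S′ _ _)))
  where
  matching = matching-colours (Colouring.colour S) (Colouring.colour S′)
    (λ a → trans (Colouring.count-colour S a)
      (trans (cong (λ m → count (+ n) (+ m) a) deg≡) (sym (Colouring.count-colour S′ a))))

H-doubleStar : ∀ m k → DoubleStar (H (2 ℕ.+ m) k) 0F 1F
H-doubleStar m k = record { w≢u = λ () ; centre = centre ; touching = touching }
  where
  centre : ∀ {i} → 0F ≢ i → Hadj (2 ℕ.+ m) k 0F i ≡ true
  centre {zero} 0≢0 = contradiction refl 0≢0
  centre {suc i} _ = refl
  touching : Off.Touching (H (2 ℕ.+ m) k) 0F 1F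
  touching {zero} (Off.offEdge 0≢0 _ _) = contradiction refl 0≢0
  touching {suc i} {zero} (Off.offEdge _ 0≢0 _) = contradiction refl 0≢0
  touching {suc zero} {suc j} e = inj₁ refl
  touching {suc (suc i)} {suc zero} e = inj₂ refl
  -- The adjacency has become `not (toℕ i ≡ᵇ toℕ j) ∧ false`, which computes only once the first
  -- factor is known.
  touching {suc (suc i)} {suc (suc j)} (Off.offEdge _ _ i∼j) with toℕ i ℕ.≡ᵇ toℕ j
  touching {suc (suc i)} {suc (suc j)} (Off.offEdge _ _ ()) | true
  touching {suc (suc i)} {suc (suc j)} (Off.offEdge _ _ ()) | false

count-below : ∀ {m k} → k ≤ m → ∑ {m} (λ j → ⟦ toℕ j ℕ.<ᵇ k ⟧) ≡ + k
count-below {ℕ.zero} ℕ.z≤n = ∑-zero 0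
count-below {ℕ.suc m} ℕ.z≤n = ∑-zero (ℕ.suc m)
count-below {ℕ.suc m} {ℕ.suc k} (ℕ.s≤s k≤m) =
  trans (∑-punchIn (λ j → ⟦ toℕ j ℕ.<ᵇ ℕ.suc k ⟧) zero) (cong (λ z → 1ℤ + z) (count-below k≤m))

deg-H : ∀ m k → k ≤ m → deg (H (2 ℕ.+ m) k) 1F ≡ ℕ.suc k
deg-H m k k≤m = ℤ.+-injective (begin
  + deg (H (2 ℕ.+ m) k) 1F ≡⟨ pos-deg (H (2 ℕ.+ m) k) 1F ⟩
  ∑ f ≡⟨ ∑-punchIn f zero ⟩
  1ℤ + ∑ (λ j → f (suc j)) ≡⟨ cong (λ z → 1ℤ + z) (∑-punchIn (λ j → f (suc j)) zero) ⟩
  1ℤ + (0ℤ + ∑ (λ j → f (suc (suc j))))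
    -- The centre has contributed 1 and vertex 1 itself 0. Vertex j + 2 is joined to vertex 1 when j
    -- + 2 ≤ k + 1, which computes to j < k.
    ≡⟨ cong (λ z → 1ℤ + (0ℤ + z)) (∑-cong (λ j → cong ⟦_⟧ (∨-identityʳ (toℕ j ℕ.<ᵇ k)))) ⟩
  1ℤ + (0ℤ + ∑ {m} (λ j → ⟦ toℕ j ℕ.<ᵇ k ⟧)) ≡⟨ cong (λ z → 1ℤ + (0ℤ + z)) (count-below k≤m) ⟩
  + ℕ.suc k ∎)
  where
  open ≡-Reasoning
  f : Fin (2 ℕ.+ m) → ℤ
  f j = ⟦ Hadj (2 ℕ.+ m) k 1F j ⟧

-- The shape is pulled back along the isomorphism so that σ can be evaluated in `G` itself.
≅-doubleStar : ∀ {n} {G G′ : Graph n} {w u} (iso : G ≅ G′) → DoubleStar G′ w u →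
  DoubleStar G (Inverse.from (proj₁ iso) w) (Inverse.from (proj₁ iso) u)
≅-doubleStar {G = G} {G′} {w} {u} (f , adj≡) S = record
  { w≢u = λ eq → w≢u (trans (sym (to-from w)) (trans (cong to eq) (to-from u)))
  ; centre = λ {i} w≢i → trans (adj≡ (from w) i)
      (trans (cong (λ v → adj G′ v (to i)) (to-from w)) (centre (to-≢ w≢i)))
  ; touching = λ e → ⊎-map from-to from-to (touching (image e))
  }
  where
  open DoubleStar S
  open Inverse f using (to; from; strictlyInverseˡ; strictlyInverseʳ)
  to-from : ∀ v → to (from v) ≡ v
  to-from = strictlyInverseˡ
  from-to : ∀ {v i} → v ≡ to i → from v ≡ i
  from-to {i = i} refl = strictlyInverseʳ i
  to-≢ : ∀ {v i} → from v ≢ i → v ≢ to i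
  to-≢ v≢i v≡i = v≢i (from-to v≡i)
  image : ∀ {i j} → Off.OffEdge G (from w) i j → Off.OffEdge G′ w (to i) (to j)
  image {i} {j} (Off.offEdge w≢i w≢j i∼j) =
    Off.offEdge (to-≢ w≢i) (to-≢ w≢j) (trans (sym (adj≡ i j)) i∼j)

doubleStar⇒t≡0 : ∀ {n k} (G : Graph n) (size≡ : size G ℕ.+ 1 ≡ n ℕ.+ k) {w u} → DoubleStar G w u →
  Size.t k G size≡ w ≡ 0ℤ
doubleStar⇒t≡0 {n} G size≡ {w} S = begin
  + n - 1ℤ - + deg G w ≡⟨ cong (λ N → N - 1ℤ - + deg G w) (sym total) ⟩
  + deg G w + 1ℤ - 1ℤ - + deg G w ≡⟨ cancel (+ deg G w) ⟩
  0ℤ ∎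
  where
  open ≡-Reasoning
  open DoubleStar S
  cancel : ∀ d → d + 1ℤ - 1ℤ - d ≡ 0ℤ
  cancel = solve-∀
  one : ∀ i → ⟦ adj G w i ⟧ + δ w i * 1ℤ ≡ 1ℤ
  one i with w ≟ i
  ... | yes refl rewrite irrefl G w = refl
  ... | no w≢i rewrite centre w≢i = refl
  total : + deg G w + 1ℤ ≡ + n
  total = begin
    + deg G w + 1ℤ ≡⟨ cong₂ _+_ (pos-deg G w) (sym (∑-δ w (λ _ → 1ℤ))) ⟩
    ∑ (λ i → ⟦ adj G w i ⟧) + ∑ (λ i → δ w i * 1ℤ) ≡⟨ ∑-+ (λ i → ⟦ adj G w i ⟧) (λ i → δ w i * 1ℤ) ⟨
    ∑ (λ i → ⟦ adj G w i ⟧ + δ w i * 1ℤ) ≡⟨ ∑-cong one ⟩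
    ∑ {n} (λ _ → 1ℤ) ≡⟨ ∑-one n ⟩
    + n ∎

-- The inequality and its equality case

module Extremality (m k : ℕ) (2≤m : 2 ≤ m) (k≤m : k ≤ m) (G : Graph (2 ℕ.+ m))
  (size≡ : size G ℕ.+ 1 ≡ 2 ℕ.+ m ℕ.+ k) where
  open Size k G size≡

  private
    n : ℕ
    n = 2 ℕ.+ m

    w : Fin n
    w = proj₁ (maximum (deg G))

  open Off G w

  doubleStar⇒≅ : ∀ {v u} → DoubleStar G v u → deg G u ≡ ℕ.suc k → G ≅ H n k
  doubleStar⇒≅ S deg≡ = doubleStar-≅ S (H-doubleStar m k) (trans deg≡ (sym (deg-H m k k≤m)))

  full-degree⇒≅ : t w ≡ 0ℤ → ∀ {u} → w ≢ u → x u ≡ K → G ≅ H n k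
  full-degree⇒≅ t≡0 {u} w≢u xu≡K = doubleStar⇒≅
    (record { w≢u = w≢u
            ; centre = centre w t≡0
            ; touching = full-degree⇒touching u (trans (∑x≡2K w t≡0) (cong (λ z → + 2 * z) (sym xu≡K))) })
    (ℤ.+-injective (trans (d≡x+α w≢u)
      (trans (cong₂ (λ y b → y + ⟦ b ⟧) xu≡K (centre w t≡0 w≢u)) (ℤ.+-comm K 1ℤ))))

  -- For K = 0 the graph G - w has no edges, so any vertex other than w has x(v) = 0 = K. The star
  -- therefore falls under the equality case.
  no-full-degree⇒1≤K : t w ≡ 0ℤ → (∀ u → w ≢ u → x u ≢ K) → 1ℤ ≤ℤ K
  no-full-degree⇒1≤K t≡0 x≢K with 1ℤ ℤ.≤? K
  ... | yes 1≤K = 1≤K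
  ... | no 1≰K = contradiction
    (ℤ.≤-antisym
      (ℤ.≤-trans (term≤∑ x-nonneg v)
        (subst₂ _≤ℤ_ (sym (trans (∑x≡2K w t≡0) (cong (λ z → + 2 * z) K≡0))) (sym K≡0) ℤ.≤-refl))
      (subst (_≤ℤ x v) (sym K≡0) (x-nonneg v)))
    (x≢K v (λ w≡v → punchInᵢ≢i w zero (sym w≡v)))
    where
    v = punchIn w zero
    K≡0 : K ≡ 0ℤ
    K≡0 = ℤ.≤-antisym (ℤ.i<j⇒i≤pred[j] (ℤ.≰⇒> 1≰K)) (lit k)

  -- One case analysis yields both claims: either the inequality is strict, or it holds together
  -- with the isomorphism that equality has to produce.
  dichotomy : 1ℤ + + sigma G ≤ℤ sigmaBound (+ n) K ⊎ (+ sigma G ≤ℤ sigmaBound (+ n) K × G ≅ H n k)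
  dichotomy with 1ℤ ℤ.≤? t w
  ... | yes 1≤t = inj₁ (nondominating w (+≤+ (ℕ.s≤s (ℕ.s≤s 2≤m))) (+≤+ k≤m)
                         (λ i → +≤+ (proj₂ (maximum (deg G)) i)) 1≤t)
  ... | no 1≰t with any? (λ u → ¬? (w ≟ u) ×-dec (x u ℤ.≟ K))
  ...   | yes (u , w≢u , xu≡K) = inj₂ (sigma≤bound w t≡0 , full-degree⇒≅ t≡0 w≢u xu≡K)
    where
    t≡0 = ℤ.≤-antisym (ℤ.i<j⇒i≤pred[j] (ℤ.≰⇒> 1≰t)) (0≤t w)
  ...   | no ¬full = inj₁ (sigma<bound w t≡0 (no-full-degree⇒1≤K t≡0 x≢K) x≢K)
    where
    t≡0 = ℤ.≤-antisym (ℤ.i<j⇒i≤pred[j] (ℤ.≰⇒> 1≰t)) (0≤t w)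
    x≢K : ∀ u → w ≢ u → x u ≢ K
    x≢K u w≢u xu≡K = ¬full (u , w≢u , xu≡K)

  sigma≤ : + sigma G ≤ℤ sigmaBound (+ n) K
  sigma≤ with dichotomy
  ... | inj₁ σ<bound = ℤ.≤-trans (ℤ.i≤suc[i] (+ sigma G)) σ<bound
  ... | inj₂ (σ≤bound , _) = σ≤bound

  equality⇒≅ : + sigma G ≡ sigmaBound (+ n) K → G ≅ H n k
  equality⇒≅ σ≡bound with dichotomy
  ... | inj₁ σ<bound = contradiction (subst (1ℤ + + sigma G ≤ℤ_) (sym σ≡bound) σ<bound) (1+i≰i (+ sigma G))
  ... | inj₂ (_ , iso) = iso

  ≅⇒equality : G ≅ H n k → + sigma G ≡ sigmaBound (+ n) K
  -- The centre is now the preimage of vertex 0, which may differ from the vertex `w` of maximum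
  -- degree chosen above; `sigma≡bound` applies to any vertex with t = 0.
  ≅⇒equality iso = sigma≡bound v (doubleStar⇒t≡0 G size≡ S) _ (DoubleStar.touching S)
    where
    v = Inverse.from (proj₁ iso) 0F
    S = ≅-doubleStar iso (H-doubleStar m k)

theorem2p4 : (n k : ℕ) → 4 ≤ n → k ≤ n ∸ 2 → (G : Graph n) → KCyclic k G →
    let N = + n
        K = + k
        bound = (N - + 1) * (N - + 2) * (N - + 2) - + 2 * K * (+ 2 * N - + 5) + K * K * (K - + 1)
    in (+ sigma G ≤ℤ bound) × ((+ sigma G ≡ bound) ⇔ (G ≅ H n k))
-- Writing n as m + 2 makes `n ∸ 2` compute to m.
theorem2p4 (ℕ.suc (ℕ.suc m)) k (ℕ.s≤s (ℕ.s≤s 2≤m)) k≤m G (_ , size≡) =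
  subst (λ B → (+ sigma G ≤ℤ B) × ((+ sigma G ≡ B) ⇔ (G ≅ H (2 ℕ.+ m) k))) (sigmaBound-def (+ (2 ℕ.+ m)) (+ k))
    (sigma≤ , mk⇔ equality⇒≅ ≅⇒equality)
  where open Extremality m k 2≤m k≤m G size≡
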